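{- For every constant $\epsilon>0$: for every sufficiently large $n$ there is a cardinality bound $k=k(n)$ such that, for every distribution $\mathcal D$ on $2^N$ ($|N|=n$), the class of monotone submodular functions on $N$ is not $n^{ -1/4+\epsilon}$-optimizable from samples over $\mathcal D$ under the constraint $\{S\subseteq N:|S|\le k\}$.
   Context: A function $f:2^N\to\mathbb R$ is monotone if $f(S\cup\{e\})\ge f(S)$ and submodular if $f(S\cup\{e\})-f(S)\ge f(T\cup\{e\})-f(T)$ for all $S\subseteq T\subseteq N$, $e\in N$. Optimization from samples: a class $\mathcal F$ is $\alpha$-optimizable from samples over a distribution $\mathcal D$ on $2^N$ under $\mathcal M=\{S:|S|\le k\}$ if there exists a (not necessarily polynomial-time, possibly randomized) algorithm which, for every $f\in\mathcal F$, given $m\in\mathrm{poly}(n)$ pairs $(S_i,f(S_i))$ with $S_i$ drawn i.i.d. from $\mathcal D$, returns $S\in\mathcal M$ with $\Pr_{S_1,\dots,S_m}\big[\mathbb E[f(S)]\ge\alpha\max_{T\in\mathcal M}f(T)\big]\ge1-\delta$, expectation over the algorithm's randomness, $\delta\in[0,1)$ a constant. Statements are asymptotic in $n$. -}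

module Defs where

open import Algebra.Bundles using (CommutativeRing)
open import Data.Bool.Base using (true; false)
open import Data.Empty using (⊥-elim)
open import Data.Fin.Subset using (Subset; ⊥; ⁅_⁆; _∪_; _⊆_; ∣_∣)
open import Data.List.Base as List using (List; []; _∷_)
open import Data.Nat.Base as ℕ using (ℕ; zero; suc; NonZero)
import Data.Nat.Properties as ℕ
open import Data.Product.Base using (∃; _×_; _,_; proj₁)
open import Data.Product.Relation.Binary.Pointwise.NonDependent
  using () renaming (Pointwise to ×-Pointwise)
open import Data.Sum.Base using (inj₁; inj₂)
open import Data.Vec.Base as Vec using (Vec)
open import Data.Vec.Relation.Binary.Pointwise.Inductive
  using () renaming (Pointwise to Vec-Pointwise)
open import Level using (Level; 0ℓ)
open import Relation.Binary.Bundles using (DecTotalOrder)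
open import Relation.Binary.PropositionalEquality.Core using (_≡_)
open import Relation.Binary.Structures using (IsDecTotalOrder)
open import Relation.Nullary using (¬_; yes; no)
open import Relation.Unary using (Pred; Decidable)
import Algebra.Properties.Ring
import Algebra.Properties.Semiring.Exp
import Algebra.Properties.Semiring.Mult
import Data.List.Extrema
import Relation.Binary.Construct.NonStrictToStrict
import Relation.Binary.Reasoning.Setoid

private
  variable
    a p : Level
    A : Set a
    n : ℕ

-- The real numbers, axiomatised as a Dedekind-complete ordered field with
-- decidable order.  Classically such a field is ℝ up to isomorphism, and
-- `archimedean` follows from `complete`; it is listed because constructively
-- `complete` does not produce the natural number.

record CompleteOrderedField : Set₁ where
  infix 4 _≤_
  infix 8 _⁻¹

  field
    commutativeRing : CommutativeRing 0ℓ 0ℓ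

  open CommutativeRing commutativeRing public
  open Algebra.Properties.Semiring.Mult semiring public
    using () renaming (_×_ to _×ℕ_)
  open Algebra.Properties.Semiring.Exp semiring public using (_^_)

  fromℕ : ℕ → Carrier
  fromℕ n = n ×ℕ 1#

  field
    _≤_             : Carrier → Carrier → Set
    isDecTotalOrder : IsDecTotalOrder _≈_ _≤_
    -- The value of 0# ⁻¹ is left unspecified.
    _⁻¹             : Carrier → Carrier
    *-inverseʳ      : ∀ x → ¬ (x ≈ 0#) → x * x ⁻¹ ≈ 1#
    0≉1             : ¬ (0# ≈ 1#)
    +-monoʳ-≤       : ∀ x {y z} → y ≤ z → x + y ≤ x + z
    *-nonneg        : ∀ {x y} → 0# ≤ x → 0# ≤ y → 0# ≤ x * y
    archimedean     : ∀ x → ∃ λ n → x ≤ fromℕ n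

  UpperBound : Pred Carrier 0ℓ → Pred Carrier 0ℓ
  UpperBound P u = ∀ {x} → P x → x ≤ u

  Supremum : Pred Carrier 0ℓ → Pred Carrier 0ℓ
  Supremum P s = UpperBound P s × (∀ {u} → UpperBound P u → s ≤ u)

  field
    complete : (P : Pred Carrier 0ℓ) → ∃ P → ∃ (UpperBound P) → ∃ (Supremum P)

  decTotalOrder : DecTotalOrder 0ℓ 0ℓ 0ℓ
  decTotalOrder = record { isDecTotalOrder = isDecTotalOrder }

  open DecTotalOrder decTotalOrder public
    using (_≤?_; _≟_; total; antisym; totalOrder; ≤-respʳ-≈; ≤-respˡ-≈)
    renaming (refl to ≤-refl; trans to ≤-trans; reflexive to ≤-reflexive)
  open Relation.Binary.Construct.NonStrictToStrict _≈_ _≤_ public using (_<_)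

module Powers (𝓡 : CompleteOrderedField) where
  open CompleteOrderedField 𝓡
  open Algebra.Properties.Semiring.Exp semiring using (^-homo-*; ^-assocʳ)
  open Algebra.Properties.Semiring.Mult semiring using (×-homo-+; ×1-homo-*)
  open Algebra.Properties.Ring ring using (-‿distribˡ-*; -‿distribʳ-*; -‿involutive)
  private module ≈-Reasoning = Relation.Binary.Reasoning.Setoid setoid

  private
    +-monoˡ-≤ : ∀ z {x y} → x ≤ y → x + z ≤ y + z
    +-monoˡ-≤ z {x} {y} h =
      ≤-respˡ-≈ (+-comm z x) (≤-respʳ-≈ (+-comm z y) (+-monoʳ-≤ z h))

    0≤y-x : ∀ {x y} → x ≤ y → 0# ≤ y - x
    0≤y-x {x} h = ≤-respˡ-≈ (-‿inverseʳ x) (+-monoˡ-≤ (- x) h)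

    cancel : ∀ x y → (y - x) + x ≈ y
    cancel x y = trans (+-assoc y (- x) x) (trans (+-congˡ (-‿inverseˡ x)) (+-identityʳ y))

    0≤y-x⇒x≤y : ∀ {x y} → 0# ≤ y - x → x ≤ y
    0≤y-x⇒x≤y {x} {y} h = ≤-respˡ-≈ (+-identityˡ x) (≤-respʳ-≈ (cancel x y) (+-monoˡ-≤ x h))

    *-monoʳ-≤ : ∀ {z} → 0# ≤ z → ∀ {x y} → x ≤ y → z * x ≤ z * y
    *-monoʳ-≤ {z} 0≤z {x} {y} h = 0≤y-x⇒x≤y (≤-respʳ-≈ eq (*-nonneg 0≤z (0≤y-x h)))
      where
      eq : z * (y - x) ≈ z * y - z * x
      eq = trans (distribˡ z y (- x)) (+-congˡ (sym (-‿distribʳ-* z x)))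

    *-monoˡ-≤ : ∀ {z} → 0# ≤ z → ∀ {x y} → x ≤ y → x * z ≤ y * z
    *-monoˡ-≤ {z} 0≤z {x} {y} h =
      ≤-respˡ-≈ (*-comm z x) (≤-respʳ-≈ (*-comm z y) (*-monoʳ-≤ 0≤z h))

    0≤1 : 0# ≤ 1#
    0≤1 with total 0# 1#
    ... | inj₁ h = h
    ... | inj₂ h = ≤-respʳ-≈ eq (*-nonneg 0≤-1 0≤-1)
      where
      0≤-1 : 0# ≤ - 1#
      0≤-1 = ≤-respʳ-≈ (+-identityˡ (- 1#)) (0≤y-x h)
      eq : - 1# * - 1# ≈ 1#
      eq = begin
        - 1# * - 1#     ≈⟨ -‿distribˡ-* 1# (- 1#) ⟨
        - (1# * - 1#)   ≈⟨ -‿cong (*-identityˡ (- 1#)) ⟩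
        - (- 1#)        ≈⟨ -‿involutive 1# ⟩
        1#              ∎
        where open ≈-Reasoning

    0≤fromℕ : ∀ n → 0# ≤ fromℕ n
    0≤fromℕ zero    = ≤-refl
    0≤fromℕ (suc n) = ≤-trans 0≤1 (≤-respˡ-≈ (+-identityʳ 1#) (+-monoʳ-≤ 1# (0≤fromℕ n)))

    1≤fromℕ : ∀ n .{{_ : NonZero n}} → 1# ≤ fromℕ n
    1≤fromℕ (suc n) = ≤-respˡ-≈ (+-identityʳ 1#) (+-monoʳ-≤ 1# (0≤fromℕ n))

    fromℕ-cancel-≤ : ∀ m n → fromℕ m ≤ fromℕ n → m ℕ.≤ n
    fromℕ-cancel-≤ zero    n       _ = ℕ.z≤n
    fromℕ-cancel-≤ (suc m) zero    h = ⊥-elim (0≉1 (antisym 0≤1 (≤-trans (1≤fromℕ (suc m)) h)))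
    fromℕ-cancel-≤ (suc m) (suc n) h = ℕ.s≤s (fromℕ-cancel-≤ m n
      (≤-respˡ-≈ (strip (fromℕ m)) (≤-respʳ-≈ (strip (fromℕ n)) (+-monoʳ-≤ (- 1#) h))))
      where
      strip : ∀ x → - 1# + (1# + x) ≈ x
      strip x = trans (sym (+-assoc (- 1#) 1# x))
                  (trans (+-congʳ (-‿inverseˡ 1#)) (+-identityˡ x))

    *-cancelʳ-≤ : ∀ {x y z} → 1# ≤ z → x * z ≤ y * z → x ≤ y
    *-cancelʳ-≤ {x} {y} {z} 1≤z h with total x y
    ... | inj₁ x≤y = x≤y
    ... | inj₂ y≤x = ≤-reflexive (trans (undo x) (trans (*-congʳ xz≈yz) (sym (undo y))))
      where
      z≉0 : ¬ (z ≈ 0#)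
      z≉0 z≈0 = 0≉1 (antisym 0≤1 (≤-respʳ-≈ z≈0 1≤z))
      undo : ∀ w → w ≈ (w * z) * z ⁻¹
      undo w = sym (trans (*-assoc w z (z ⁻¹))
                 (trans (*-congˡ (*-inverseʳ z z≉0)) (*-identityʳ w)))
      xz≈yz : x * z ≈ y * z
      xz≈yz = antisym h (*-monoˡ-≤ (≤-trans 0≤1 1≤z) y≤x)

    1≤^ : ∀ {b} → 1# ≤ b → ∀ k → 1# ≤ b ^ k
    1≤^ 1≤b zero = ≤-refl
    1≤^ {b} 1≤b (suc k) = ≤-trans 1≤b
      (≤-respˡ-≈ (*-identityʳ b) (*-monoʳ-≤ (≤-trans 0≤1 1≤b) (1≤^ 1≤b k)))

    ^-monoʳ-≤ : ∀ {b} → 1# ≤ b → ∀ {j k} → j ℕ.≤ k → b ^ j ≤ b ^ k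
    ^-monoʳ-≤ 1≤b {k = k} ℕ.z≤n = 1≤^ 1≤b k
    ^-monoʳ-≤ 1≤b (ℕ.s≤s j≤k) = *-monoʳ-≤ (≤-trans 0≤1 1≤b) (^-monoʳ-≤ 1≤b j≤k)

    ^-cancel-≤ : ∀ {s t} → 1# ≤ s → ∀ q → t ^ suc q ≤ s ^ suc q → t ≤ s
    ^-cancel-≤ {s} {t} 1≤s q h with total t s
    ... | inj₁ t≤s = t≤s
    ... | inj₂ s≤t = *-cancelʳ-≤ (1≤^ 1≤s q) (≤-trans (*-monoʳ-≤ 0≤t (^-mono q)) h)
      where
      0≤s = ≤-trans 0≤1 1≤s
      0≤t = ≤-trans 0≤s s≤t
      0≤s^ : ∀ q → 0# ≤ s ^ q
      0≤s^ q = ≤-trans 0≤1 (1≤^ 1≤s q)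
      ^-mono : ∀ q → s ^ q ≤ t ^ q
      ^-mono zero    = ≤-refl
      ^-mono (suc q) = ≤-trans (*-monoˡ-≤ (0≤s^ q) s≤t) (*-monoʳ-≤ 0≤t (^-mono q))

  -- For b ≥ 1, b ^ʳ r is the supremum of the rational powers b ^ (w / d) with
  -- w / d ≤ r and d ≥ 1.  Here w = u - v and d = suc q, and b ^ (w / d) is in turn
  -- the supremum of the t ≥ 0 with t ^ d ≤ b ^ w; the two suprema are merged.
  BelowPower : Carrier → Carrier → Pred Carrier 0ℓ
  BelowPower b r t = 0# ≤ t × ∃ λ u → ∃ λ v → ∃ λ q →
    fromℕ u ≤ fromℕ v + r * fromℕ (suc q) × t ^ suc q * b ^ v ≤ b ^ u

  belowPower-supremum : ∀ {b} → 1# ≤ b → ∀ r → ∃ (Supremum (BelowPower b r))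
  belowPower-supremum {b} 1≤b r =
    complete (BelowPower b r) (0# , inhabited) (b ^ proj₁ (archimedean r) , bounded)
    where
    inhabited : BelowPower b r 0#
    inhabited with v , -r≤v ← archimedean (- r) =
      ≤-refl , 0 , v , 0 , 0≤v+r , ≤-trans (≤-reflexive 0b≈0) 0≤1
      where
      0≤v+r : 0# ≤ fromℕ v + r * fromℕ 1
      0≤v+r = ≤-respˡ-≈ (-‿inverseˡ r) (≤-respʳ-≈
        (+-congˡ (sym (trans (*-congˡ (+-identityʳ 1#)) (*-identityʳ r)))) (+-monoˡ-≤ r -r≤v))
      0b≈0 : 0# ^ 1 * b ^ v ≈ 0#
      0b≈0 = trans (*-congʳ (zeroˡ 1#)) (zeroˡ (b ^ v))

    bounded : UpperBound (BelowPower b r) (b ^ proj₁ (archimedean r))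
    bounded {t} (_ , u , v , q , u≤ , tᵈbᵛ≤bᵘ) with M , r≤M ← archimedean r =
      ^-cancel-≤ (1≤^ 1≤b M) q (*-cancelʳ-≤ (1≤^ 1≤b v)
        (≤-trans tᵈbᵛ≤bᵘ (≤-trans (^-monoʳ-≤ 1≤b u≤Md+v) (≤-reflexive eq))))
      where
      u≤Md+v : u ℕ.≤ M ℕ.* suc q ℕ.+ v
      u≤Md+v = fromℕ-cancel-≤ u _ (≤-trans u≤ (≤-trans
        (+-monoʳ-≤ (fromℕ v) (*-monoˡ-≤ (0≤fromℕ (suc q)) r≤M)) (≤-reflexive (begin
          fromℕ v + fromℕ M * fromℕ (suc q)    ≈⟨ +-comm _ _ ⟩
          fromℕ M * fromℕ (suc q) + fromℕ v    ≈⟨ +-congʳ (×1-homo-* M (suc q)) ⟨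
          fromℕ (M ℕ.* suc q) + fromℕ v        ≈⟨ ×-homo-+ 1# (M ℕ.* suc q) v ⟨
          fromℕ (M ℕ.* suc q ℕ.+ v)            ∎))))
        where open ≈-Reasoning
      eq : b ^ (M ℕ.* suc q ℕ.+ v) ≈ (b ^ M) ^ suc q * b ^ v
      eq = trans (^-homo-* b (M ℕ.* suc q) v) (*-congʳ (sym (^-assocʳ b M (suc q))))

  infixr 8 _^ʳ_

  _^ʳ_ : (n : ℕ) .{{_ : NonZero n}} → Carrier → Carrier
  n ^ʳ r = proj₁ (belowPower-supremum (1≤fromℕ n) r)

vectors : List A → ∀ m → List (Vec A m)
vectors xs zero    = Vec.[] ∷ []
vectors xs (suc m) = List.cartesianProductWith Vec._∷_ xs (vectors xs m)

subsets : ∀ n → List (Subset n)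
subsets n = vectors (false ∷ true ∷ []) n

PolynomiallyBounded : (ℕ → ℕ) → Set
PolynomiallyBounded m = ∃ λ c → ∃ λ d → ∀ n → m n ℕ.≤ c ℕ.* n ℕ.^ d ℕ.+ c

-- The ground set N is Fin n.

module Optimization (𝓡 : CompleteOrderedField) where
  open CompleteOrderedField 𝓡
  open Data.List.Extrema totalOrder using (max)
  open Powers 𝓡 public using (_^ʳ_)

  SetFunction : ℕ → Set
  SetFunction n = Subset n → Carrier

  Nonnegative : Pred (SetFunction n) 0ℓ
  Nonnegative f = ∀ S → 0# ≤ f S

  Monotone : Pred (SetFunction n) 0ℓ
  Monotone f = ∀ S e → f S ≤ f (S ∪ ⁅ e ⁆)

  Submodular : Pred (SetFunction n) 0ℓ
  Submodular f = ∀ S T e → S ⊆ T → f (T ∪ ⁅ e ⁆) - f T ≤ f (S ∪ ⁅ e ⁆) - f S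

  MonotoneSubmodular : Pred (SetFunction n) 0ℓ
  MonotoneSubmodular f = Monotone f × Submodular f

  -- Nonnegativity is tacit in multiplicative approximation: if f is constantly -1
  -- and α < 1, then not even an optimal S satisfies f S ≥ α · max f, so a class
  -- containing such an f is never α-optimizable.
  NonnegativeMonotoneSubmodular : Pred (SetFunction n) 0ℓ
  NonnegativeMonotoneSubmodular f = Nonnegative f × MonotoneSubmodular f

  ∑ : List A → (A → Carrier) → Carrier
  ∑ xs f = List.foldr _+_ 0# (List.map f xs)

  record Distribution (n : ℕ) : Set where
    field
      weight       : Subset n → Carrier
      nonnegative  : ∀ S → 0# ≤ weight S
      total-weight : ∑ (subsets n) weight ≈ 1#

  open Distribution public

  𝔼 : Distribution n → SetFunction n → Carrier
  𝔼 {n} D f = ∑ (subsets n) λ S → weight D S * f S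

  -- The probability of an event about m independent draws from D.
  Pr : Distribution n → ∀ {m} {P : Pred (Vec (Subset n) m) p} → Decidable P → Carrier
  Pr {n = n} D {m} P? = ∑ (List.filter P? (vectors (subsets n) m)) λ Ss →
    Vec.foldr′ _*_ 1# (Vec.map (weight D) Ss)

  maxFeasible : ℕ → SetFunction n → Carrier
  maxFeasible {n} k f =
    max (f ⊥) (List.map f (List.filter (λ T → ∣ T ∣ ℕ.≤? k) (subsets n)))

  -- A randomised algorithm maps m labelled samples to the distribution of its output,
  -- which has cardinality at most k.  `run-cong` says that it is a function of the
  -- real numbers f S rather than of their representatives.
  record Algorithm (n m k : ℕ) : Set where
    field
      run      : Vec (Subset n × Carrier) m → Distribution n
      run-cong : ∀ {xs ys} → Vec-Pointwise (×-Pointwise _≡_ _≈_) xs ys →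
                 ∀ S → weight (run xs) S ≈ weight (run ys) S
      feasible : ∀ xs S → k ℕ.< ∣ S ∣ → weight (run xs) S ≈ 0#

  open Algorithm public

  labelled : SetFunction n → ∀ {m} → Vec (Subset n) m → Vec (Subset n × Carrier) m
  labelled f = Vec.map (λ S → S , f S)

  -- Optimizability at a single n, from m samples and with failure probability δ.
  OptimizableFromSamples : Pred (SetFunction n) 0ℓ → (α : Carrier) → Distribution n →
                           (k m : ℕ) (δ : Carrier) → Set
  OptimizableFromSamples {n} 𝓕 α D k m δ =
    ∃ λ (𝒜 : Algorithm n m k) → ∀ f → 𝓕 f →
      1# - δ ≤ Pr D (λ Ss → α * maxFeasible k f ≤? 𝔼 (run 𝒜 (labelled f Ss)) f)

  -- Hence non-optimizability of the nonnegative monotone submodular functions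
  -- implies that of all monotone submodular functions.
  optimizable-⊆ : ∀ {𝓕 𝓖 : Pred (SetFunction n) 0ℓ} {α D k m δ} →
                  (∀ {f} → 𝓖 f → 𝓕 f) →
                  OptimizableFromSamples 𝓕 α D k m δ → OptimizableFromSamples 𝓖 α D k m δ
  optimizable-⊆ 𝓖⊆𝓕 (𝒜 , h) = 𝒜 , λ f f∈𝓖 → h f (𝓖⊆𝓕 f∈𝓖)

{-# OPTIONS --safe #-}

-- Write x = q^e with 1/e ≤ ε and q = ⌊n^(1/4e)⌋, so that x is about n^(1/4).  Hide a random
-- set T consisting of one element from each of x² disjoint blocks of size x², cut into x groups
-- of k = x elements, one of which, A, is good.  The function
--     min (kθ, θ |S ∩ A| + k |S| + min (θq, θ |S ∩ (T ∖ A)|)),   θ = x² / q,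
-- has maximum kθ, attained at A.  It does not depend on which group is good unless |S| < θ
-- and |S ∩ T| > q: a set of size ≥ θ is saturated by the term k |S|, and a smaller one meets T in
-- less than one element on average, so the exception has probability at most 2^-q over T.
-- Fix a T for which a sample from D is exceptional with probability at most 2^-q.  Outside an event
-- of probability m 2^-q, the output of the algorithm is independent of the good group, and
-- summing over the x groups shows that its value is at most about 3q/x of the optimum on average.
module Submission where

open import Defs
open import Data.Nat.Base as ℕ using (ℕ; NonZero)
open import Data.Product.Base using (∃; _×_; _,_; proj₁; proj₂)
open import Relation.Nullary using (¬_; yes; no)

-- Natural number estimates: capped sums, growth rates, integer roots, powers of 1 + 1/b.

module Naturals where
  open import Data.Nat.Base
  open import Data.Nat.DivMod using (_/_; _%_; m≡m%n+[m/n]*n; m%n<n; m/n*n≤m)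
  open import Data.Nat.Properties
  open import Data.Nat.Solver using (module +-*-Solver)
  open import Relation.Binary.PropositionalEquality.Core using (_≡_; refl; trans; cong; subst)
  open import Data.Sum.Base using (inj₁; inj₂)
  open +-*-Solver using (solve; _:=_; _:+_; _:*_; con)
  open ≤-Reasoning

  -- Lets a cap at `c` preserve submodularity, with `x`, `y`, `u`, `v` the values at S, S ∪ e, T, T
  -- ∪ e. If `y` or `u` reaches `c`, that term dominates `c ⊓ v` and monotonicity handles `c ⊓ x`;
  -- otherwise both caps on the right are inactive.
  ⊓-concave : ∀ c {x y u v} → x ≤ y → x ≤ u → v + x ≤ y + u →
              (c ⊓ v) + (c ⊓ x) ≤ (c ⊓ y) + (c ⊓ u)
  ⊓-concave c {x} {y} {u} {v} x≤y x≤u v+x≤y+u with ≤-total c y | ≤-total c u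
  ... | inj₁ c≤y | _ rewrite m≤n⇒m⊓n≡m c≤y = +-mono-≤ (m⊓n≤m c v) (⊓-monoʳ-≤ c x≤u)
  ... | inj₂ y≤c | inj₁ c≤u rewrite m≤n⇒m⊓n≡m c≤u =
    ≤-trans (≤-reflexive (+-comm (c ⊓ v) (c ⊓ x))) (+-mono-≤ (⊓-monoʳ-≤ c x≤y) (m⊓n≤m c v))
  ... | inj₂ y≤c | inj₂ u≤c rewrite m≥n⇒m⊓n≡n y≤c | m≥n⇒m⊓n≡n u≤c =
    ≤-trans (+-mono-≤ (m⊓n≤n c v) (m⊓n≤n c x)) v+x≤y+u

  1+m≤2^m : ∀ m → suc m ≤ 2 ^ m
  1+m≤2^m zero    = ≤-refl
  1+m≤2^m (suc m) = begin
    suc (suc m)          ≤⟨ +-mono-≤ (m^n>0 2 m) (1+m≤2^m m) ⟩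
    2 ^ m + 2 ^ m        ≡⟨ cong (2 ^ m +_) (+-identityʳ (2 ^ m)) ⟨
    2 ^ suc m            ∎

  ^-distribʳ-* : ∀ m n o → (m * n) ^ o ≡ m ^ o * n ^ o
  ^-distribʳ-* m n zero    = refl
  ^-distribʳ-* m n (suc o) = trans (cong (m * n *_) (^-distribʳ-* m n o))
    (solve 4 (λ a b c d → a :* b :* (c :* d) := a :* c :* (b :* d)) refl m n (m ^ o) (n ^ o))

  -- With x = ⌊q / D⌋, q ≤ D (x + 1) ≤ D 2^x.
  q^D≤D^D*2^q : ∀ q D .{{_ : NonZero D}} → q ^ D ≤ D ^ D * 2 ^ q
  q^D≤D^D*2^q q D = begin
    q ^ D                      ≤⟨ ^-monoˡ-≤ D q≤ ⟩
    (D * 2 ^ (q / D)) ^ D      ≡⟨ ^-distribʳ-* D (2 ^ (q / D)) D ⟩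
    D ^ D * (2 ^ (q / D)) ^ D  ≡⟨ cong (D ^ D *_) (^-*-assoc 2 (q / D) D) ⟩
    D ^ D * 2 ^ (q / D * D)    ≤⟨ *-monoʳ-≤ (D ^ D) (^-monoʳ-≤ 2 (m/n*n≤m q D)) ⟩
    D ^ D * 2 ^ q              ∎
    where
    q≤ : q ≤ D * 2 ^ (q / D)
    q≤ = begin
      q                   ≡⟨ m≡m%n+[m/n]*n q D ⟩
      q % D + q / D * D   ≤⟨ +-monoˡ-≤ (q / D * D) (<⇒≤ (m%n<n q D)) ⟩
      suc (q / D) * D     ≡⟨ *-comm (suc (q / D)) D ⟩
      D * suc (q / D)     ≤⟨ *-monoʳ-≤ D (1+m≤2^m (q / D)) ⟩
      D * 2 ^ (q / D)     ∎

  -- The preceding bound is used at exponent `suc D`: the spare factor `q` absorbs both its constant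
  -- `A` and `C`.
  exponential-beats-power : ∀ C D → ∃ λ Q → ∀ q → Q ≤ q → C * q ^ D ≤ 2 ^ q
  exponential-beats-power C D = A * C , λ q AC≤q → *-cancelˡ-≤ A (begin
    A * (C * q ^ D)   ≡⟨ *-assoc A C (q ^ D) ⟨
    A * C * q ^ D     ≤⟨ *-monoˡ-≤ (q ^ D) AC≤q ⟩
    q ^ suc D         ≤⟨ q^D≤D^D*2^q q (suc D) ⟩
    A * 2 ^ q         ∎)
    where
    A = suc D ^ suc D
    instance
      A≢0 : NonZero A
      A≢0 = m^n≢0 (suc D) (suc D)

  -- Brings a polynomial number of samples, for a ground set of at most `q ^ p` elements, into the
  -- monomial form that `exponential-beats-power` compares with `2 ^ q`.
  bounded-after-scaling : ∀ {m} c d p N q → m ≤ c * (q ^ p) ^ d + c → 1 ≤ q →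
                          2 * N * m ≤ 4 * N * c * q ^ (p * d)
  bounded-after-scaling {m} c d p N q m≤ 1≤q = begin
    2 * N * m                                ≤⟨ *-monoʳ-≤ (2 * N) m≤ ⟩
    2 * N * (c * (q ^ p) ^ d + c)            ≡⟨ cong (λ z → 2 * N * (c * z + c)) (^-*-assoc q p d) ⟩
    2 * N * (c * q ^ (p * d) + c)            ≤⟨ *-monoʳ-≤ (2 * N) (+-monoʳ-≤ (c * q ^ (p * d))
                                                  (m≤m*n c (q ^ (p * d)))) ⟩
    2 * N * (c * q ^ (p * d) + c * q ^ (p * d))
      ≡⟨ solve 3 (λ N c x → con 2 :* N :* (c :* x :+ c :* x) := con 4 :* N :* c :* x) refl N c (q ^ (p * d)) ⟩
    4 * N * c * q ^ (p * d)                  ∎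
    where
    instance
      q≢0 : NonZero q
      q≢0 = >-nonZero 1≤q
      x≢0 : NonZero (q ^ (p * d))
      x≢0 = m^n≢0 q (p * d)

  root : ∀ d .{{_ : NonZero d}} n → ∃ λ q → q ^ d ≤ n × n < suc q ^ d
  root (suc d) zero = 0 , z≤n , m^n>0 1 (suc d)
  root (suc d) (suc n) with root (suc d) n
  ... | q , q^d≤n , n<q with suc q ^ suc d ≤? suc n
  -- One increment is enough, because `suc n` ≤ (q + 1)^d < (q + 2)^d with exponent d = `suc d`.
  ... | yes q+1≤ = suc q , q+1≤ , ≤-<-trans n<q (^-monoˡ-< (suc d) (n<1+n (suc q)))
  ... | no  q+1≰ = q , ≤-trans q^d≤n (n≤1+n n) , ≰⇒> q+1≰

  root-large : ∀ d .{{_ : NonZero d}} {n} Q → Q ^ d ≤ n → Q ≤ proj₁ (root d n)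
  root-large d {n} Q Q^d≤n with proj₁ (root d n) in eq | proj₂ (proj₂ (root d n))
  ... | q | n<q with Q ≤? q
  ... | yes Q≤q = Q≤q
  ... | no  Q≰q with () ← <-irrefl refl (≤-<-trans Q^d≤n (≤-trans n<q (^-monoˡ-≤ d (≰⇒> Q≰q))))

  -- Follows from q + 1 ≤ 2q. Applied to the integer root, it gives n ≤ q^(d+1), so rounding the
  -- root down costs a single factor `q`.
  suc^≤^suc : ∀ q d → 2 ^ d ≤ q → suc q ^ d ≤ q ^ suc d
  suc^≤^suc q d 2^d≤q = begin
    suc q ^ d       ≤⟨ ^-monoˡ-≤ d (begin
      1 + q   ≤⟨ +-monoˡ-≤ q (≤-trans (m^n>0 2 d) 2^d≤q) ⟩
      q + q   ≡⟨ cong (q +_) (+-identityʳ q) ⟨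
      2 * q   ∎) ⟩
    (2 * q) ^ d     ≡⟨ ^-distribʳ-* 2 q d ⟩
    2 ^ d * q ^ d   ≤⟨ *-monoˡ-≤ (q ^ d) 2^d≤q ⟩
    q ^ suc d       ∎

  -- This is 1 + s/b ≤ (1 + 1/b)^s with denominators cleared.
  bernoulli : ∀ b s → (b + s) * b ^ s ≤ b * suc b ^ s
  bernoulli b zero    = ≤-reflexive (cong (_* 1) (+-identityʳ b))
  bernoulli b (suc s) = begin
    (b + suc s) * (b * b ^ s)                      ≤⟨ m≤m+n _ (s * b ^ s) ⟩
    (b + suc s) * (b * b ^ s) + s * b ^ s
      ≡⟨ solve 3 (λ b s x → (b :+ (con 1 :+ s)) :* (b :* x) :+ s :* x
                          := (con 1 :+ b) :* ((b :+ s) :* x)) refl b s (b ^ s) ⟩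
    suc b * ((b + s) * b ^ s)                      ≤⟨ *-monoʳ-≤ (suc b) (bernoulli b s) ⟩
    suc b * (b * suc b ^ s)
      ≡⟨ solve 2 (λ b y → (con 1 :+ b) :* (b :* y) := b :* ((con 1 :+ b) :* y)) refl b (suc b ^ s) ⟩
    b * suc b ^ suc s                              ∎

  -- With denominators cleared this is (1 + 1/b)^s (1 - s/b) ≤ 1. Each step of the induction trades
  -- (b + 1) d for b (d + 1), which is no smaller since d ≤ b.
  suc^*-≤ : ∀ s {b d} → s + d ≡ b → suc b ^ s * d ≤ b ^ s * b
  suc^*-≤ zero    refl = ≤-refl
  suc^*-≤ (suc s) {b} {d} s+d≡b = begin
    suc b * suc b ^ s * d
      ≡⟨ solve 3 (λ b x d → (con 1 :+ b) :* x :* d := x :* (d :+ b :* d)) refl b (suc b ^ s) d ⟩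
    suc b ^ s * (d + b * d)    ≤⟨ *-monoʳ-≤ (suc b ^ s) (+-monoˡ-≤ (b * d) d≤b) ⟩
    suc b ^ s * (b + b * d)
      ≡⟨ solve 3 (λ b x d → x :* (b :+ b :* d) := x :* (con 1 :+ d) :* b) refl b (suc b ^ s) d ⟩
    suc b ^ s * suc d * b      ≤⟨ *-monoˡ-≤ b (suc^*-≤ s (trans (+-suc s d) s+d≡b)) ⟩
    b ^ s * b * b
      ≡⟨ solve 2 (λ b x → x :* b :* b := b :* x :* b) refl b (b ^ s) ⟩
    b * b ^ s * b              ∎
    where
    d≤b : d ≤ b
    d≤b = subst (d ≤_) s+d≡b (m≤n+m d (suc s))

  -- Here 1 - s/b ≥ 1/2, so the preceding inequality gives (1 + 1/b)^s ≤ 2.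
  suc^≤2*^ : ∀ {b s} → .{{NonZero b}} → 2 * s ≤ b → suc b ^ s ≤ 2 * b ^ s
  suc^≤2*^ {b} {s} 2s≤b = *-cancelʳ-≤ _ _ b (begin
    suc b ^ s * b               ≤⟨ *-monoʳ-≤ (suc b ^ s) b≤2d ⟩
    suc b ^ s * (2 * (b ∸ s))
      ≡⟨ solve 2 (λ x d → x :* (con 2 :* d) := con 2 :* (x :* d)) refl (suc b ^ s) (b ∸ s) ⟩
    2 * (suc b ^ s * (b ∸ s))   ≤⟨ *-monoʳ-≤ 2 (suc^*-≤ s s+d≡b) ⟩
    2 * (b ^ s * b)             ≡⟨ *-assoc 2 (b ^ s) b ⟨
    2 * b ^ s * b               ∎)
    where
    s+d≡b : s + (b ∸ s) ≡ b
    s+d≡b = m+[n∸m]≡n (≤-trans (m≤m+n s (s + 0)) 2s≤b)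
    b≤2d : b ≤ 2 * (b ∸ s)
    b≤2d = +-cancelˡ-≤ (2 * s) _ _ (begin
      2 * s + b                ≤⟨ +-monoˡ-≤ b 2s≤b ⟩
      b + b                    ≡⟨ cong (λ z → z + z) s+d≡b ⟨
      s + (b ∸ s) + (s + (b ∸ s))
        ≡⟨ solve 2 (λ s d → s :+ d :+ (s :+ d) := con 2 :* s :+ con 2 :* d) refl s (b ∸ s) ⟩
      2 * s + 2 * (b ∸ s)      ∎)

  -- With x = q^(e′+4) and z = q^e′, a gain 6 N x³ q z cannot reach x³ q³ z.
  parameters-incompatible : ∀ {N} e′ q → 6 * N < q → let x = q ^ (4 + e′); θ = x * q ^ (3 + e′) in
    ¬ (x * (x * θ) ≤ 2 * N * (θ * x + x * (x * x + θ * q)) * q ^ suc e′)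
  parameters-incompatible {N} e′ q@(suc _) 6N<q h = <⇒≱ 6N<q (begin
    q          ≤⟨ m≤m*n q q ⟩
    q * q      ≤⟨ *-cancelˡ-≤ (x * x * x * (q * z)) {{nonzero}} (begin
      x * x * x * (q * z) * (q * q)
        ≡⟨ solve 3 (λ x q z → x :* x :* x :* (q :* z) :* (q :* q)
               := x :* (x :* (x :* (q :* (q :* (q :* z)))))) refl x q z ⟩
      x * (x * θ)
        ≤⟨ h ⟩
      2 * N * (θ * x + x * (x * x + θ * q)) * (q * z)
        ≤⟨ *-monoˡ-≤ (q * z) (*-monoʳ-≤ (2 * N) (+-monoˡ-≤ _ (*-monoʳ-≤ θ (m≤n*m x q)))) ⟩
      2 * N * (θ * (q * x) + x * (x * x + θ * q)) * (q * z)
        ≡⟨ solve 4 (λ N x q z → let y = q :* (q :* (q :* (q :* z))); t = x :* (q :* (q :* (q :* z))) in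
               con 2 :* N :* (t :* (q :* x) :+ x :* (x :* x :+ t :* q)) :* (q :* z)
               := con 2 :* N :* (x :* y :* x :+ x :* (x :* x :+ x :* y)) :* (q :* z)) refl N x q z ⟩
      2 * N * (x * x * x + x * (x * x + x * x)) * (q * z)
        ≡⟨ solve 4 (λ N x q z → con 2 :* N :* (x :* x :* x :+ x :* (x :* x :+ x :* x)) :* (q :* z)
               := x :* x :* x :* (q :* z) :* (con 6 :* N)) refl N x q z ⟩
      x * x * x * (q * z) * (6 * N) ∎) ⟩
    6 * N      ∎)
    where
    x = q ^ (4 + e′)
    z = q ^ e′
    θ = x * q ^ (3 + e′)
    nonzero : NonZero (x * x * x * (q * z))
    nonzero = m*n≢0 (x * x * x) (q * z) {{m*n≢0 (x * x) x {{m*n≢0 x x {{x≢0}} {{x≢0}}}} {{x≢0}}}}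
                {{m*n≢0 q z {{_}} {{m^n≢0 q e′}}}}
      where
      x≢0 : NonZero x
      x≢0 = m^n≢0 q (4 + e′)

open Naturals

-- Finite subsets and their cardinalities.

module Sets where
  open import Data.Bool.Base using (true; false; if_then_else_)
  open import Data.Empty using (⊥-elim)
  open import Data.Fin.Base using (Fin; zero; suc)
  open import Data.Fin.Subset
  open import Data.Fin.Subset.Properties
  open import Data.List.Base as List using (List; []; _∷_; length; cartesianProductWith)
  open import Data.List.Membership.Propositional using () renaming (_∈_ to _∈ₗ_)
  open import Data.List.Membership.Propositional.Properties
    using (∈-cartesianProductWith⁺; ∈-cartesianProductWith⁻; ∈-tabulate⁻)
  open import Data.List.Properties
    using (map-++; map-cong; map-∘; map-tabulate; tabulate-cong; length-++; length-map; length-tabulate)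
  open import Data.List.Relation.Unary.Any using (here; there)
  open import Data.Nat.Base hiding (_/_)
  open import Data.Nat.ListAction using (sum)
  open import Data.Nat.ListAction.Properties using (sum-++)
  open import Data.Nat.Properties
  open import Data.Nat.Solver using (module +-*-Solver)
  open import Data.Vec.Base as Vec using ([]; _∷_; _++_; here; there)
  open import Data.Vec.Properties using (zipWith-++)
  open import Function.Base using (_∘_; case_of_)
  open import Level using (Level)
  open import Relation.Binary.PropositionalEquality.Core using (_≡_; refl; sym; trans; cong; cong₂; subst)
  open import Relation.Nullary using (Dec; does; _×-dec_)
  open +-*-Solver using (solve; _:=_; _:+_; _:*_; con)
  open ≤-Reasoning

  private
    variable
      a : Level
      A B : Set a
      m n b : ℕ

  ∣++∣ : (p : Subset m) (q : Subset n) → ∣ p ++ q ∣ ≡ ∣ p ∣ + ∣ q ∣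
  ∣++∣ []          q = refl
  ∣++∣ (true ∷ p)  q = cong suc (∣++∣ p q)
  ∣++∣ (false ∷ p) q = ∣++∣ p q

  ∣++∩++∣ : (p p′ : Subset m) (q q′ : Subset n) → ∣ (p ++ q) ∩ (p′ ++ q′) ∣ ≡ ∣ p ∩ p′ ∣ + ∣ q ∩ q′ ∣
  ∣++∩++∣ p p′ q q′ =
    trans (cong ∣_∣ (zipWith-++ _ p q p′ q′)) (∣++∣ (p ∩ p′) (q ∩ q′))

  ∣p∩⊤∣≡∣p∣ : (p : Subset n) → ∣ p ∩ ⊤ ∣ ≡ ∣ p ∣
  ∣p∩⊤∣≡∣p∣ p = cong ∣_∣ (∩-identityʳ p)

  ∣p∩⊥∣≡0 : (p : Subset n) → ∣ p ∩ ⊥ ∣ ≡ 0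
  ∣p∩⊥∣≡0 {n} p = trans (cong ∣_∣ (∩-zeroʳ p)) (∣⊥∣≡0 n)

  ∣p∩q∣+∣p∩∁q∣≡∣p∣ : (p q : Subset n) → ∣ p ∩ q ∣ + ∣ p ∩ ∁ q ∣ ≡ ∣ p ∣
  ∣p∩q∣+∣p∩∁q∣≡∣p∣ []          []          = refl
  ∣p∩q∣+∣p∩∁q∣≡∣p∣ (false ∷ p) (_ ∷ q)     = ∣p∩q∣+∣p∩∁q∣≡∣p∣ p q
  ∣p∩q∣+∣p∩∁q∣≡∣p∣ (true ∷ p)  (true ∷ q)  = cong suc (∣p∩q∣+∣p∩∁q∣≡∣p∣ p q)
  ∣p∩q∣+∣p∩∁q∣≡∣p∣ (true ∷ p)  (false ∷ q) =
    trans (+-suc ∣ p ∩ q ∣ ∣ p ∩ ∁ q ∣) (cong suc (∣p∩q∣+∣p∩∁q∣≡∣p∣ p q))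

  -- Insertion of elements, modular functions and their truncations.

  ∪⁅e⁆-absorb : ∀ {e} {p : Subset n} → e ∈ p → p ∪ ⁅ e ⁆ ≡ p
  ∪⁅e⁆-absorb {e = e} {p} e∈p = ⊆-antisym
    (λ x∈ → case x∈p∪q⁻ p ⁅ e ⁆ x∈ of λ where
      (inj₁ x∈p) → x∈p
      (inj₂ x∈e) → subst (_∈ p) (sym (x∈⁅y⁆⇒x≡y e x∈e)) e∈p)
    (p⊆p∪q ⁅ e ⁆)
    where open import Data.Sum.Base using (inj₁; inj₂)

  ∣∪⁅e⁆∩∣ : ∀ {e} (p q : Subset n) → e ∉ p → ∣ (p ∪ ⁅ e ⁆) ∩ q ∣ ≡ ∣ ⁅ e ⁆ ∩ q ∣ + ∣ p ∩ q ∣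
  ∣∪⁅e⁆∩∣ {e = zero} (true ∷ p) q           e∉p = ⊥-elim (e∉p here)
  ∣∪⁅e⁆∩∣ {suc n} {zero} (false ∷ p) (true ∷ q)  e∉p rewrite ∪-identityʳ p | ∩-zeroˡ q | ∣⊥∣≡0 n = refl
  ∣∪⁅e⁆∩∣ {suc n} {zero} (false ∷ p) (false ∷ q) e∉p rewrite ∪-identityʳ p | ∩-zeroˡ q | ∣⊥∣≡0 n = refl
  ∣∪⁅e⁆∩∣ {e = suc e} (true ∷ p) (true ∷ q) e∉p =
    trans (cong suc (∣∪⁅e⁆∩∣ p q (e∉p ∘ there))) (sym (+-suc ∣ ⁅ e ⁆ ∩ q ∣ ∣ p ∩ q ∣))
  ∣∪⁅e⁆∩∣ {e = suc e} (true ∷ p) (false ∷ q) e∉p = ∣∪⁅e⁆∩∣ p q (e∉p ∘ there)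
  ∣∪⁅e⁆∩∣ {e = suc e} (false ∷ p) (_ ∷ q)    e∉p = ∣∪⁅e⁆∩∣ p q (e∉p ∘ there)

  -- Modularity is phrased by single insertions, as submodularity is. Monotonicity is a field
  -- because each instance has it directly, without an induction along a chain from `S` to `T`.
  record Modular (μ : Subset n → ℕ) : Set where
    field
      marginal  : Fin n → ℕ
      insertion : ∀ S {e} → e ∉ S → μ (S ∪ ⁅ e ⁆) ≡ marginal e + μ S
      monotone  : ∀ {S T} → S ⊆ T → μ S ≤ μ T
  open Modular

  modular-∩ : (A : Subset n) → Modular (λ S → ∣ S ∩ A ∣)
  modular-∩ A = record
    { marginal  = λ e → ∣ ⁅ e ⁆ ∩ A ∣
    ; insertion = λ S e∉S → ∣∪⁅e⁆∩∣ S A e∉S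
    ; monotone  = λ {S} S⊆T → p⊆q⇒∣p∣≤∣q∣
                    (λ x∈ → let x∈S , x∈A = x∈p∩q⁻ S A x∈ in x∈p∩q⁺ (S⊆T x∈S , x∈A))
    }

  modular-∣∣ : Modular {n} ∣_∣
  modular-∣∣ = record
    { marginal  = λ _ → 1
    ; insertion = λ S {e} e∉S → trans (sym (∣p∩⊤∣≡∣p∣ (S ∪ ⁅ e ⁆))) (trans (∣∪⁅e⁆∩∣ S ⊤ e∉S)
                    (cong₂ _+_ (trans (∣p∩⊤∣≡∣p∣ ⁅ e ⁆) (∣⁅x⁆∣≡1 e)) (∣p∩⊤∣≡∣p∣ S)))
    ; monotone  = p⊆q⇒∣p∣≤∣q∣
    }

  modular-+ : {μ ν : Subset n → ℕ} → Modular μ → Modular ν → Modular (λ S → μ S + ν S)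
  modular-+ {μ = μ} {ν} M N = record
    { marginal  = λ e → marginal M e + marginal N e
    ; insertion = λ S {e} e∉S → trans (cong₂ _+_ (insertion M S e∉S) (insertion N S e∉S))
        (solve 4 (λ a b c d → a :+ b :+ (c :+ d) := a :+ c :+ (b :+ d)) refl
          (marginal M e) (μ S) (marginal N e) (ν S))
    ; monotone  = λ S⊆T → +-mono-≤ (monotone M S⊆T) (monotone N S⊆T)
    }

  modular-* : ∀ c {μ : Subset n → ℕ} → Modular μ → Modular (λ S → c * μ S)
  modular-* c {μ} M = record
    { marginal  = λ e → c * marginal M e
    ; insertion = λ S {e} e∉S → trans (cong (c *_) (insertion M S e∉S)) (*-distribˡ-+ c (marginal M e) (μ S))
    ; monotone  = λ S⊆T → *-monoʳ-≤ c (monotone M S⊆T)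
    }

  -- The shape of the hard functions: the inner cap `τ` limits the contribution of the bad part of
  -- the hidden set, the outer cap `K` is the optimum.
  module Truncation (K τ : ℕ) {μ ν : Subset n → ℕ} (M : Modular μ) (N : Modular ν) where
    inner : Subset n → ℕ
    inner S = μ S + τ ⊓ ν S

    truncated : Subset n → ℕ
    truncated S = K ⊓ inner S

    inner-monotone : ∀ {S T} → S ⊆ T → inner S ≤ inner T
    inner-monotone S⊆T = +-mono-≤ (monotone M S⊆T) (⊓-monoʳ-≤ τ (monotone N S⊆T))

    truncated-monotone : ∀ {S T} → S ⊆ T → truncated S ≤ truncated T
    truncated-monotone S⊆T = ⊓-monoʳ-≤ K (inner-monotone S⊆T)

    -- As `e` lies outside `T`, hence outside `S`, both modular functions have equal marginals at
    -- `S` and `T`. The capped one is then handled by `⊓-concave`.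
    inner-submodular : ∀ {S T e} → S ⊆ T → e ∉ T →
                       inner (T ∪ ⁅ e ⁆) + inner S ≤ inner (S ∪ ⁅ e ⁆) + inner T
    inner-submodular {S} {T} {e} S⊆T e∉T = begin
      μ Te + τ ⊓ ν Te + (μ S + τ ⊓ ν S)
        ≡⟨ rearrange (μ Te) (τ ⊓ ν Te) (μ S) (τ ⊓ ν S) ⟩
      μ Te + μ S + (τ ⊓ ν Te + τ ⊓ ν S)
        ≤⟨ +-mono-≤ (exchange M) (⊓-concave τ (monotone N (p⊆p∪q ⁅ e ⁆)) (monotone N S⊆T) (exchange N)) ⟩
      μ Se + μ T + (τ ⊓ ν Se + τ ⊓ ν T)
        ≡⟨ rearrange (μ Se) (τ ⊓ ν Se) (μ T) (τ ⊓ ν T) ⟨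
      μ Se + τ ⊓ ν Se + (μ T + τ ⊓ ν T) ∎
      where
      Se = S ∪ ⁅ e ⁆
      Te = T ∪ ⁅ e ⁆
      rearrange : ∀ a b c d → a + b + (c + d) ≡ a + c + (b + d)
      rearrange = solve 4 (λ a b c d → a :+ b :+ (c :+ d) := a :+ c :+ (b :+ d)) refl
      exchange : ∀ {ρ : Subset n → ℕ} → Modular ρ → ρ Te + ρ S ≤ ρ Se + ρ T
      exchange {ρ} R rewrite insertion R T e∉T | insertion R S (e∉T ∘ S⊆T) = ≤-reflexive
        (solve 3 (λ d t s → d :+ t :+ s := d :+ s :+ t) refl (marginal R e) (ρ T) (ρ S))

    truncated-submodular : ∀ {S T} e → S ⊆ T →
      truncated (T ∪ ⁅ e ⁆) + truncated S ≤ truncated (S ∪ ⁅ e ⁆) + truncated T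
    truncated-submodular {S} {T} e S⊆T with e ∈? T
    -- The marginal at `T` is zero, so monotonicity at `S` suffices.
    ... | yes e∈T rewrite ∪⁅e⁆-absorb e∈T = begin
      truncated T + truncated S             ≤⟨ +-monoʳ-≤ (truncated T) (truncated-monotone (p⊆p∪q ⁅ e ⁆)) ⟩
      truncated T + truncated (S ∪ ⁅ e ⁆)   ≡⟨ +-comm (truncated T) _ ⟩
      truncated (S ∪ ⁅ e ⁆) + truncated T   ∎
    ... | no e∉T = ⊓-concave K (inner-monotone (p⊆p∪q ⁅ e ⁆)) (inner-monotone S⊆T)
                     (inner-submodular S⊆T e∉T)

  -- Product families and the exponential moment of an intersection.

  infixr 5 _⊗_
  _⊗_ : List (Subset m) → List (Subset n) → List (Subset (m + n))
  _⊗_ = cartesianProductWith _++_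

  sumOver : List A → (A → ℕ) → ℕ
  sumOver xs f = sum (List.map f xs)

  indicator : Dec A → ℕ
  indicator d = if does d then 1 else 0

  sumOver-++ : ∀ (xs ys : List A) f → sumOver (xs List.++ ys) f ≡ sumOver xs f + sumOver ys f
  sumOver-++ xs ys f = trans (cong sum (map-++ f xs ys)) (sum-++ (List.map f xs) (List.map f ys))

  sumOver-*ˡ : ∀ (xs : List A) c f → sumOver xs (λ x → c * f x) ≡ c * sumOver xs f
  sumOver-*ˡ []       c f = sym (*-zeroʳ c)
  sumOver-*ˡ (x ∷ xs) c f = trans (cong (c * f x +_) (sumOver-*ˡ xs c f))
                              (sym (*-distribˡ-+ c (f x) (sumOver xs f)))

  sumOver-mono : ∀ (xs : List A) {f g} → (∀ x → f x ≤ g x) → sumOver xs f ≤ sumOver xs g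
  sumOver-mono []       f≤g = z≤n
  sumOver-mono (x ∷ xs) f≤g = +-mono-≤ (f≤g x) (sumOver-mono xs f≤g)

  sumOver-+const : ∀ (xs : List A) f c → sumOver xs (λ x → f x + c) ≡ sumOver xs f + length xs * c
  sumOver-+const []       f c = refl
  sumOver-+const (x ∷ xs) f c = trans (cong (f x + c +_) (sumOver-+const xs f c))
    (solve 4 (λ a b d e → a :+ b :+ (d :+ e) := a :+ d :+ (b :+ e)) refl
      (f x) c (sumOver xs f) (length xs * c))

  -- The unnormalised exponential moment: for `T` uniform in `L` it is `length L` times the
  -- expectation of 2^|S ∩ T|, ready for Markov's inequality.
  generating : List (Subset n) → Subset n → ℕ
  generating L S = sumOver L (λ T → 2 ^ ∣ S ∩ T ∣)

  -- Independence of the two halves: cardinalities of intersections add under `++`, so the powers of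
  -- 2 multiply and the double sum factors.
  generating-⊗ : ∀ (L : List (Subset m)) (L′ : List (Subset n)) S S′ →
                 generating (L ⊗ L′) (S ++ S′) ≡ generating L S * generating L′ S′
  generating-⊗ []      L′ S S′ = refl
  generating-⊗ (T ∷ L) L′ S S′ = begin-equality
    generating (List.map (T ++_) L′ List.++ (L ⊗ L′)) (S ++ S′)
      ≡⟨ sumOver-++ (List.map (T ++_) L′) (L ⊗ L′) _ ⟩
    generating (List.map (T ++_) L′) (S ++ S′) + generating (L ⊗ L′) (S ++ S′)
      ≡⟨ cong₂ _+_ head (generating-⊗ L L′ S S′) ⟩
    2 ^ ∣ S ∩ T ∣ * generating L′ S′ + generating L S * generating L′ S′
      ≡⟨ *-distribʳ-+ (generating L′ S′) (2 ^ ∣ S ∩ T ∣) (generating L S) ⟨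
    (2 ^ ∣ S ∩ T ∣ + generating L S) * generating L′ S′ ∎
    where
    head : generating (List.map (T ++_) L′) (S ++ S′) ≡ 2 ^ ∣ S ∩ T ∣ * generating L′ S′
    head = begin-equality
      generating (List.map (T ++_) L′) (S ++ S′)
        ≡⟨ cong sum (map-∘ L′) ⟨
      sumOver L′ (λ T′ → 2 ^ ∣ (S ++ S′) ∩ (T ++ T′) ∣)
        ≡⟨ cong sum (map-cong (λ T′ → trans (cong (2 ^_) (∣++∩++∣ S T S′ T′))
                                        (^-distribˡ-+-* 2 ∣ S ∩ T ∣ ∣ S′ ∩ T′ ∣)) L′) ⟩
      sumOver L′ (λ T′ → 2 ^ ∣ S ∩ T ∣ * 2 ^ ∣ S′ ∩ T′ ∣)
        ≡⟨ sumOver-*ˡ L′ (2 ^ ∣ S ∩ T ∣) _ ⟩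
      2 ^ ∣ S ∩ T ∣ * generating L′ S′ ∎

  length-⊗ : ∀ (L : List (Subset m)) (L′ : List (Subset n)) → length (L ⊗ L′) ≡ length L * length L′
  length-⊗ []      L′ = refl
  length-⊗ (T ∷ L) L′ = trans (length-++ (List.map (T ++_) L′))
                          (cong₂ _+_ (length-map (T ++_) L′) (length-⊗ L L′))

  -- For T uniform in L, 𝔼 2^∣S∩T∣ ≤ (1 + 1/b)^∣S∣.
  record Spread (b : ℕ) (L : List (Subset n)) : Set where
    constructor spreads
    field moment : ∀ S → generating L S * b ^ ∣ S ∣ ≤ length L * suc b ^ ∣ S ∣

  -- Both sides of the moment bound are multiplicative under concatenation.
  spread-⊗ : {L : List (Subset m)} {L′ : List (Subset n)} →
             Spread b L → Spread b L′ → Spread b (L ⊗ L′)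
  spread-⊗ {m} {b = b} {L} {L′} (spreads h) (spreads h′) .Spread.moment SS
    with S , S′ , refl ← Vec.splitAt m SS = begin
    generating (L ⊗ L′) (S ++ S′) * b ^ ∣ S ++ S′ ∣
      ≡⟨ cong₂ _*_ (generating-⊗ L L′ S S′) (split b) ⟩
    generating L S * generating L′ S′ * (b ^ ∣ S ∣ * b ^ ∣ S′ ∣)
      ≡⟨ rearrange (generating L S) (generating L′ S′) (b ^ ∣ S ∣) (b ^ ∣ S′ ∣) ⟩
    generating L S * b ^ ∣ S ∣ * (generating L′ S′ * b ^ ∣ S′ ∣)
      ≤⟨ *-mono-≤ (h S) (h′ S′) ⟩
    length L * suc b ^ ∣ S ∣ * (length L′ * suc b ^ ∣ S′ ∣)
      ≡⟨ rearrange (length L) (length L′) (suc b ^ ∣ S ∣) (suc b ^ ∣ S′ ∣) ⟨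
    length L * length L′ * (suc b ^ ∣ S ∣ * suc b ^ ∣ S′ ∣)
      ≡⟨ cong₂ _*_ (length-⊗ L L′) (split (suc b)) ⟨
    length (L ⊗ L′) * suc b ^ ∣ S ++ S′ ∣ ∎
    where
    split : ∀ x → x ^ ∣ S ++ S′ ∣ ≡ x ^ ∣ S ∣ * x ^ ∣ S′ ∣
    split x = trans (cong (x ^_) (∣++∣ S S′)) (^-distribˡ-+-* x ∣ S ∣ ∣ S′ ∣)
    rearrange : ∀ a b c d → a * b * (c * d) ≡ a * c * (b * d)
    rearrange = solve 4 (λ a b c d → a :* b :* (c :* d) := a :* c :* (b :* d)) refl

  -- Blocks, groups and hidden sets.

  singletons : ∀ b → List (Subset b)
  singletons b = List.tabulate ⁅_⁆

  -- A point of the block contributes 2 if it lies in `S` and 1 otherwise. The mean is thus 1 +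
  -- |S|/b, and `bernoulli` yields the spread bound.
  generating-singletons : (S : Subset b) → generating (singletons b) S ≡ b + ∣ S ∣
  generating-singletons S = trans (cong sum (map-tabulate ⁅_⁆ (λ T → 2 ^ ∣ S ∩ T ∣))) (go S)
    where
    go : ∀ {b} (S : Subset b) → sum (List.tabulate (λ e → 2 ^ ∣ S ∩ ⁅ e ⁆ ∣)) ≡ b + ∣ S ∣
    go []          = refl
    go (true ∷ S)  rewrite ∣p∩⊥∣≡0 S = trans (cong (2 +_) (go S)) (cong suc (sym (+-suc _ ∣ S ∣)))
    go (false ∷ S) rewrite ∣p∩⊥∣≡0 S = cong suc (go S)

  spread-singletons : Spread b (singletons b)
  spread-singletons {b} .Spread.moment S
    rewrite generating-singletons S | length-tabulate {n = b} ⁅_⁆ = bernoulli b ∣ S ∣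

  spread-⊥ : Spread b (⊥ {n} ∷ [])
  spread-⊥ {b} .Spread.moment S rewrite ∣p∩⊥∣≡0 S = *-monoʳ-≤ 1 (^-monoˡ-≤ ∣ S ∣ (n≤1+n b))

  -- The size of `r` consecutive copies of width `s` followed by `c` padding elements. The recursion
  -- makes the types of the concatenations below agree by computation.
  width : (s c r : ℕ) → ℕ
  width s c zero    = c
  width s c (suc r) = s + width s c r

  width≡ : ∀ s c r → width s c r ≡ r * s + c
  width≡ s c zero    = refl
  width≡ s c (suc r) = trans (cong (s +_) (width≡ s c r)) (sym (+-assoc s (r * s) c))

  power : List (Subset n) → ∀ c r → List (Subset (width n c r))
  power L c zero    = ⊥ ∷ []
  power L c (suc r) = L ⊗ power L c r

  spread-power : {L : List (Subset n)} → Spread b L → ∀ c r → Spread b (power L c r)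
  spread-power h c zero    = spread-⊥
  spread-power h c (suc r) = spread-⊗ h (spread-power h c r)

  power-inhabited : {L : List (Subset n)} → ∃ (_∈ₗ L) → ∀ c r → ∃ (_∈ₗ power L c r)
  power-inhabited h         c zero    = ⊥ , here refl
  power-inhabited (T , T∈L) c (suc r) with T′ , T′∈ ← power-inhabited (T , T∈L) c r =
    T ++ T′ , ∈-cartesianProductWith⁺ _++_ T∈L T′∈

  power-card : ∀ {L : List (Subset n)} {a} → (∀ {T} → T ∈ₗ L → ∣ T ∣ ≡ a) →
               ∀ c r {T} → T ∈ₗ power L c r → ∣ T ∣ ≡ r * a
  power-card h c zero    (here refl) = ∣⊥∣≡0 c
  power-card {L = L} h c (suc r) T∈
    with T , T′ , T∈L , T′∈ , refl ← ∈-cartesianProductWith⁻ _++_ L (power L c r) T∈ =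
    trans (∣++∣ T T′) (cong₂ _+_ (h T∈L) (power-card h c r T′∈))

  group : ∀ s c r → Fin r → Subset (width s c r)
  group s c (suc r) zero    = ⊤ {s} ++ ⊥
  group s c (suc r) (suc i) = ⊥ {s} ++ group s c r i

  ∣++∩⊤++⊥∣ : (p : Subset m) (q : Subset n) → ∣ (p ++ q) ∩ (⊤ {m} ++ ⊥) ∣ ≡ ∣ p ∣
  ∣++∩⊤++⊥∣ p q = trans (∣++∩++∣ p ⊤ q ⊥)
    (trans (cong₂ _+_ (∣p∩⊤∣≡∣p∣ p) (∣p∩⊥∣≡0 q)) (+-identityʳ ∣ p ∣))

  ∣++∩⊥++∣ : (p : Subset m) (q q′ : Subset n) → ∣ (p ++ q) ∩ (⊥ {m} ++ q′) ∣ ≡ ∣ q ∩ q′ ∣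
  ∣++∩⊥++∣ p q q′ = trans (∣++∩++∣ p ⊥ q q′) (cong (_+ ∣ q ∩ q′ ∣) (∣p∩⊥∣≡0 p))

  group-card : ∀ {L : List (Subset n)} {a} → (∀ {T} → T ∈ₗ L → ∣ T ∣ ≡ a) →
               ∀ c r i {T} → T ∈ₗ power L c r → ∣ T ∩ group n c r i ∣ ≡ a
  group-card {L = L} h c (suc r) i T∈
    with T , T′ , T∈L , T′∈ , refl ← ∈-cartesianProductWith⁻ _++_ L (power L c r) T∈ with i
  ... | zero  = trans (∣++∩⊤++⊥∣ T T′) (h T∈L)
  ... | suc i = trans (∣++∩⊥++∣ T T′ _) (group-card h c r i T′∈)

  groups-disjoint : ∀ s c r (P : Subset (width s c r)) →
                    sumOver (List.allFin r) (λ i → ∣ P ∩ group s c r i ∣) ≤ ∣ P ∣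
  groups-disjoint s c r P =
    ≤-trans (≤-reflexive (cong sum (map-tabulate (λ i → i) (λ i → ∣ P ∩ group s c r i ∣)))) (go r P)
    where
    go : ∀ r (P : Subset (width s c r)) → sum (List.tabulate (λ i → ∣ P ∩ group s c r i ∣)) ≤ ∣ P ∣
    go zero    P = z≤n
    go (suc r) P with Q , Q′ , refl ← Vec.splitAt s P = begin
      ∣ (Q ++ Q′) ∩ (⊤ {s} ++ ⊥) ∣ + sum (List.tabulate (λ i → ∣ (Q ++ Q′) ∩ (⊥ {s} ++ group s c r i) ∣))
        ≡⟨ cong₂ _+_ (∣++∩⊤++⊥∣ Q Q′) (cong sum (tabulate-cong (λ i → ∣++∩⊥++∣ Q Q′ (group s c r i)))) ⟩
      ∣ Q ∣ + sum (List.tabulate (λ i → ∣ Q′ ∩ group s c r i ∣))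
        ≤⟨ +-monoʳ-≤ ∣ Q ∣ (go r Q′) ⟩
      ∣ Q ∣ + ∣ Q′ ∣   ≡⟨ ∣++∣ Q Q′ ⟨
      ∣ Q ++ Q′ ∣      ∎

  -- Each member of `family` is a hidden set; its good parts are its intersections with the groups.
  record HiddenPartitions (n r k b : ℕ) : Set where
    field
      family    : List (Subset n)
      inhabited : ∃ (_∈ₗ family)
      spread    : Spread b family
      parts     : Fin r → Subset n
      part-card : ∀ {T} → T ∈ₗ family → ∀ i → ∣ T ∩ parts i ∣ ≡ k
      disjoint  : ∀ P → sumOver (List.allFin r) (λ i → ∣ P ∩ parts i ∣) ≤ ∣ P ∣

  -- Two nested powers: `k` blocks of size `b`, with one hidden element in each, form a group; `r`
  -- groups followed by `c` padding elements fill the ground set. The padding belongs to no group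
  -- and to no hidden set.
  hiddenPartitions : ∀ {n} r k b .{{_ : NonZero b}} → r * (k * b) ≤ n → HiddenPartitions n r k b
  hiddenPartitions {n} r k b rkb≤n = subst (λ n → HiddenPartitions n r k b) width≡n (record
    { family    = power blocks c r
    ; inhabited = power-inhabited (power-inhabited (singleton b) 0 k) c r
    ; spread    = spread-power (spread-power spread-singletons 0 k) c r
    ; parts     = group s c r
    ; part-card = λ T∈ i → trans (group-card (power-card one 0 k) c r i T∈) (*-identityʳ k)
    ; disjoint  = groups-disjoint s c r
    })
    where
    s = width b 0 k
    c = n ∸ r * (k * b)
    blocks = power (singletons b) 0 k
    width≡n : width s c r ≡ n
    width≡n = trans (width≡ s c r) (trans
      (cong (λ s → r * s + c) (trans (width≡ b 0 k) (+-identityʳ (k * b)))) (m+[n∸m]≡n rkb≤n))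
    singleton : ∀ b .{{_ : NonZero b}} → ∃ (_∈ₗ singletons b)
    singleton (suc b) = _ , here refl
    one : ∀ {T} → T ∈ₗ singletons b → ∣ T ∣ ≡ 1
    one T∈ with i , refl ← ∈-tabulate⁻ T∈ = ∣⁅x⁆∣≡1 i

  -- Rarity of the samples that can reveal the good group.

  Exposed : (θ t : ℕ) → Subset n → Subset n → Set
  Exposed θ t T S = ∣ S ∣ < θ × t < ∣ S ∩ T ∣

  exposed? : ∀ θ t (T S : Subset n) → Dec (Exposed θ t T S)
  exposed? θ t T S = (∣ S ∣ <? θ) ×-dec (t <? ∣ S ∩ T ∣)

  -- The pointwise form of Markov's inequality.
  indicator-bound : ∀ (d : Dec A) c {x} → (A → c ≤ x) → c * indicator d ≤ x
  indicator-bound (yes a) c h = ≤-trans (≤-reflexive (*-identityʳ c)) (h a)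
  indicator-bound (no _)  c h = ≤-trans (≤-reflexive (*-zeroʳ c)) z≤n

  -- For |S| < θ ≤ b/2 the mean of 2^|S ∩ T| is at most (1 + 1/b)^|S| ≤ 2. The strict inequality in
  -- `Exposed` allows Markov's inequality at 2^(t+1), and the extra factor 2 cancels this constant.
  exposed-rare : ∀ {θ t} .{{_ : NonZero b}} → 2 * θ ≤ b → {L : List (Subset n)} → Spread b L →
    ∀ S → 2 ^ t * sumOver L (λ T → indicator (exposed? θ t T S)) ≤ length L
  exposed-rare {b = b} {θ = θ} {t} 2θ≤b {L} (spreads moment) S with ∣ S ∣ <? θ
  ... | no  s≮θ = begin
    2 ^ t * sumOver L (λ T → indicator (exposed? θ t T S))
      ≡⟨ sumOver-*ˡ L (2 ^ t) _ ⟨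
    sumOver L (λ T → 2 ^ t * indicator (exposed? θ t T S))
      ≤⟨ sumOver-mono L (λ T → indicator-bound (exposed? θ t T S) (2 ^ t) (⊥-elim ∘ s≮θ ∘ proj₁)) ⟩
    -- Zero is written as `0 * 0` so that `sumOver-*ˡ` evaluates the sum.
    sumOver L (λ _ → 0 * 0)   ≡⟨ sumOver-*ˡ L 0 (λ _ → 0) ⟩
    0                         ≤⟨ z≤n ⟩
    length L ∎
  ... | yes s<θ = *-cancelˡ-≤ 2 (begin
    2 * (2 ^ t * sumOver L (λ T → indicator (exposed? θ t T S)))
      ≡⟨ *-assoc 2 (2 ^ t) _ ⟨
    2 ^ suc t * sumOver L (λ T → indicator (exposed? θ t T S))
      ≡⟨ sumOver-*ˡ L (2 ^ suc t) _ ⟨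
    sumOver L (λ T → 2 ^ suc t * indicator (exposed? θ t T S))
      ≤⟨ sumOver-mono L (λ T → indicator-bound (exposed? θ t T S) (2 ^ suc t) (^-monoʳ-≤ 2 ∘ proj₂)) ⟩
    generating L S
      ≤⟨ *-cancelʳ-≤ _ _ (b ^ ∣ S ∣) {{m^n≢0 b ∣ S ∣}} (begin
           generating L S * b ^ ∣ S ∣     ≤⟨ moment S ⟩
           length L * suc b ^ ∣ S ∣       ≤⟨ *-monoʳ-≤ (length L) (suc^≤2*^ {b} {∣ S ∣}
                                            (≤-trans (*-monoʳ-≤ 2 (<⇒≤ s<θ)) 2θ≤b)) ⟩
           length L * (2 * b ^ ∣ S ∣)
             ≡⟨ solve 2 (λ l x → l :* (con 2 :* x) := con 2 :* l :* x) refl (length L) (b ^ ∣ S ∣) ⟩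
           2 * length L * b ^ ∣ S ∣       ∎) ⟩
    2 * length L ∎)

open Sets

-- Ordered-field arithmetic and a lower bound for the real power.

module FieldProperties (𝓡 : CompleteOrderedField) where
  import Algebra.Solver.Ring.NaturalCoefficients.Default
  open import Data.Empty using (⊥-elim)
  import Data.Nat.Properties as ℕ
  open import Data.Sum.Base using (inj₁; inj₂)
  import Relation.Binary.Bundles
  import Relation.Binary.Reasoning.PartialOrder
  import Algebra.Properties.Semiring.Mult
  import Algebra.Properties.Semiring.Exp
  import Algebra.Properties.CommutativeSemiring.Exp
  import Algebra.Properties.Ring
  open CompleteOrderedField 𝓡
  open Algebra.Properties.Semiring.Mult semiring using (×-homo-+; ×1-homo-*)
  open Algebra.Properties.Semiring.Exp semiring using (^-congˡ)
  open Algebra.Properties.CommutativeSemiring.Exp commutativeSemiring using (^-distrib-*)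
  open Algebra.Properties.Ring ring using (-‿distribˡ-*; -‿involutive; -1*x≈-x)
  open Powers 𝓡
  open Relation.Binary.Reasoning.PartialOrder
    (Relation.Binary.Bundles.DecTotalOrder.poset decTotalOrder) public
  module Solver = Algebra.Solver.Ring.NaturalCoefficients.Default commutativeSemiring
  open Solver using (solve; _:=_; _:*_)

  ≰⇒≥ : ∀ {x y} → ¬ (x ≤ y) → y ≤ x
  ≰⇒≥ {x} {y} x≰y with total x y
  ... | inj₁ x≤y = ⊥-elim (x≰y x≤y)
  ... | inj₂ y≤x = y≤x

  +-monoˡ-≤ : ∀ z {x y} → x ≤ y → x + z ≤ y + z
  +-monoˡ-≤ z {x} {y} x≤y = begin
    x + z   ≈⟨ +-comm x z ⟩
    z + x   ≤⟨ +-monoʳ-≤ z x≤y ⟩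
    z + y   ≈⟨ +-comm z y ⟩
    y + z   ∎

  +-mono-≤ : ∀ {x y u v} → x ≤ y → u ≤ v → x + u ≤ y + v
  +-mono-≤ {y = y} {u} x≤y u≤v = ≤-trans (+-monoˡ-≤ u x≤y) (+-monoʳ-≤ y u≤v)

  [x+y]-y≈x : ∀ x y → (x + y) - y ≈ x
  [x+y]-y≈x x y = trans (+-assoc x y (- y)) (trans (+-congˡ (-‿inverseʳ y)) (+-identityʳ x))

  [x-y]+y≈x : ∀ x y → (x - y) + y ≈ x
  [x-y]+y≈x x y = trans (+-assoc x (- y) y) (trans (+-congˡ (-‿inverseˡ y)) (+-identityʳ x))

  +-cancelʳ-≤ : ∀ z {x y} → x + z ≤ y + z → x ≤ y
  +-cancelʳ-≤ z {x} {y} h = begin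
    x             ≈⟨ [x+y]-y≈x x z ⟨
    x + z - z     ≤⟨ +-monoˡ-≤ (- z) h ⟩
    y + z - z     ≈⟨ [x+y]-y≈x y z ⟩
    y             ∎

  x≤y⇒0≤y-x : ∀ {x y} → x ≤ y → 0# ≤ y - x
  x≤y⇒0≤y-x {x} {y} x≤y = ≤-respˡ-≈ (-‿inverseʳ x) (+-monoˡ-≤ (- x) x≤y)

  -- Converts the subtraction-free submodularity proved over the naturals into the inequality
  -- between marginals.
  -‿mono-≤ : ∀ {x y z u} → x + u ≤ z + y → x - y ≤ z - u
  -‿mono-≤ {x} {y} {z} {u} h = +-cancelʳ-≤ (y + u) (begin
    x - y + (y + u)    ≈⟨ +-assoc (x - y) y u ⟨
    x - y + y + u      ≈⟨ +-congʳ ([x-y]+y≈x x y) ⟩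
    x + u              ≤⟨ h ⟩
    z + y              ≈⟨ +-congʳ ([x-y]+y≈x z u) ⟨
    z - u + u + y      ≈⟨ +-assoc (z - u) u y ⟩
    z - u + (u + y)    ≈⟨ +-congˡ (+-comm u y) ⟩
    z - u + (y + u)    ∎)

  *-monoʳ-≤ : ∀ {z} → 0# ≤ z → ∀ {x y} → x ≤ y → z * x ≤ z * y
  *-monoʳ-≤ {z} 0≤z {x} {y} x≤y = begin
    z * x                   ≈⟨ +-identityˡ (z * x) ⟨
    0# + z * x              ≤⟨ +-monoˡ-≤ (z * x) (*-nonneg 0≤z (x≤y⇒0≤y-x x≤y)) ⟩
    z * (y - x) + z * x     ≈⟨ distribˡ z (y - x) x ⟨
    z * (y - x + x)         ≈⟨ *-congˡ ([x-y]+y≈x y x) ⟩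
    z * y                   ∎

  *-monoˡ-≤ : ∀ {z} → 0# ≤ z → ∀ {x y} → x ≤ y → x * z ≤ y * z
  *-monoˡ-≤ {z} 0≤z {x} {y} x≤y = begin
    x * z   ≈⟨ *-comm x z ⟩
    z * x   ≤⟨ *-monoʳ-≤ 0≤z x≤y ⟩
    z * y   ≈⟨ *-comm z y ⟩
    y * z   ∎

  0≤1 : 0# ≤ 1#
  0≤1 with total 0# 1#
  ... | inj₁ 0≤1 = 0≤1
  ... | inj₂ 1≤0 = begin
    0#              ≤⟨ *-nonneg 0≤-1 0≤-1 ⟩
    - 1# * - 1#     ≈⟨ -1*x≈-x (- 1#) ⟩
    - - 1#          ≈⟨ -‿involutive 1# ⟩
    1#              ∎
    where
    0≤-1 : 0# ≤ - 1#
    0≤-1 = ≤-respʳ-≈ (+-identityˡ (- 1#)) (x≤y⇒0≤y-x 1≤0)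

  1≰0 : ¬ (1# ≤ 0#)
  1≰0 1≤0 = 0≉1 (antisym 0≤1 1≤0)

  0≤⁻¹ : ∀ {x} → 0# < x → 0# ≤ x ⁻¹
  0≤⁻¹ {x} (0≤x , 0≉x) with total 0# (x ⁻¹)
  ... | inj₁ 0≤x⁻¹ = 0≤x⁻¹
  ... | inj₂ x⁻¹≤0 = ⊥-elim (1≰0 (begin
    1#         ≈⟨ *-inverseʳ x (λ x≈0 → 0≉x (sym x≈0)) ⟨
    x * x ⁻¹   ≤⟨ *-monoʳ-≤ 0≤x x⁻¹≤0 ⟩
    x * 0#     ≈⟨ zeroʳ x ⟩
    0#         ∎))

  *-cancelˡ-≤ : ∀ {z} → 0# < z → ∀ {x y} → z * x ≤ z * y → x ≤ y
  *-cancelˡ-≤ {z} 0<z {x} {y} zx≤zy = begin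
    x                ≈⟨ undo x ⟨
    z ⁻¹ * (z * x)   ≤⟨ *-monoʳ-≤ (0≤⁻¹ 0<z) zx≤zy ⟩
    z ⁻¹ * (z * y)   ≈⟨ undo y ⟩
    y                ∎
    where
    undo : ∀ w → z ⁻¹ * (z * w) ≈ w
    undo w = trans (sym (*-assoc (z ⁻¹) z w)) (trans (*-congʳ (trans (*-comm (z ⁻¹) z)
               (*-inverseʳ z (λ z≈0 → proj₂ 0<z (sym z≈0))))) (*-identityˡ w))

  0≤fromℕ : ∀ n → 0# ≤ fromℕ n
  0≤fromℕ ℕ.zero    = ≤-refl
  0≤fromℕ (ℕ.suc n) = ≤-trans 0≤1 (≤-respˡ-≈ (+-identityʳ 1#) (+-monoʳ-≤ 1# (0≤fromℕ n)))

  fromℕ-mono-≤ : ∀ {m n} → m ℕ.≤ n → fromℕ m ≤ fromℕ n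
  fromℕ-mono-≤ {n = n} ℕ.z≤n = 0≤fromℕ n
  fromℕ-mono-≤ (ℕ.s≤s m≤n)   = +-monoʳ-≤ 1# (fromℕ-mono-≤ m≤n)

  fromℕ-+ : ∀ m n → fromℕ (m ℕ.+ n) ≈ fromℕ m + fromℕ n
  fromℕ-+ = ×-homo-+ 1#

  fromℕ-* : ∀ m n → fromℕ (m ℕ.* n) ≈ fromℕ m * fromℕ n
  fromℕ-* = ×1-homo-*

  fromℕ-^ : ∀ m n → fromℕ (m ℕ.^ n) ≈ fromℕ m ^ n
  fromℕ-^ m ℕ.zero    = +-identityʳ 1#
  fromℕ-^ m (ℕ.suc n) = trans (fromℕ-* m (m ℕ.^ n)) (*-congˡ (fromℕ-^ m n))

  fromℕ-1 : fromℕ 1 ≈ 1#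
  fromℕ-1 = +-identityʳ 1#

  fromℕ-cancel-≤ : ∀ {m n} → fromℕ m ≤ fromℕ n → m ℕ.≤ n
  fromℕ-cancel-≤ {m} {n} h with m ℕ.≤? n
  ... | yes m≤n = m≤n
  ... | no  m≰n = ⊥-elim (1≰0 (+-cancelʳ-≤ (fromℕ n) (begin
    1# + fromℕ n   ≤⟨ fromℕ-mono-≤ (ℕ.≰⇒> m≰n) ⟩
    fromℕ m        ≤⟨ h ⟩
    fromℕ n        ≈⟨ +-identityˡ (fromℕ n) ⟨
    0# + fromℕ n   ∎)))

  0<fromℕ : ∀ n .{{_ : NonZero n}} → 0# < fromℕ n
  0<fromℕ (ℕ.suc n) = 0≤fromℕ (ℕ.suc n) , λ 0≈ → 1≰0 (begin
    1#                ≈⟨ fromℕ-1 ⟨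
    fromℕ 1           ≤⟨ fromℕ-mono-≤ {1} {ℕ.suc n} (ℕ.s≤s ℕ.z≤n) ⟩
    fromℕ (ℕ.suc n)   ≈⟨ 0≈ ⟨
    0#                ∎)

  -- Any `N` above the inverse works. It replaces `ε` and `1# - δ` by reciprocals of natural
  -- numbers, leaving integer constants in the later estimates.
  archimedean-inverse : ∀ {x} → 0# < x → ∃ λ N → 1# ≤ fromℕ N * x
  archimedean-inverse {x} 0<x with N , x⁻¹≤N ← archimedean (x ⁻¹) = N , (begin
    1#            ≈⟨ *-inverseʳ x (λ x≈0 → proj₂ 0<x (sym x≈0)) ⟨
    x * x ⁻¹      ≤⟨ *-monoʳ-≤ (proj₁ 0<x) x⁻¹≤N ⟩
    x * fromℕ N   ≈⟨ *-comm x (fromℕ N) ⟩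
    fromℕ N * x   ∎)

  0<y-x : ∀ {x y} → x < y → 0# < y - x
  0<y-x {x} {y} (x≤y , x≉y) = x≤y⇒0≤y-x x≤y , λ 0≈ → x≉y (begin-equality
    x             ≈⟨ +-identityˡ x ⟨
    0# + x        ≈⟨ +-congʳ 0≈ ⟩
    y - x + x     ≈⟨ [x-y]+y≈x y x ⟩
    y             ∎)

  -- With e = e′ + 4 and 1 / e ≤ ε, n^(-1/4 + ε) ≥ n^((4 - e) / 4e) ≥ q^(3 - e).
  power-lower-bound : ∀ {ε} e′ q n .{{_ : NonZero q}} .{{_ : NonZero n}} → let e = 4 ℕ.+ e′ in
    1# ≤ fromℕ e * ε → n ℕ.≤ q ℕ.^ ℕ.suc (4 ℕ.* e) →
    1# ≤ n ^ʳ (- (fromℕ 4 ⁻¹) + ε) * fromℕ (q ℕ.^ ℕ.suc e′)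
  power-lower-bound {ε} e′ q n 1≤eε n≤ = begin
    1#                                            ≈⟨ xY≈1 ⟨
    x * Y                                         ≤⟨ *-monoˡ-≤ (0≤fromℕ y) x≤α ⟩
    n ^ʳ (- (fromℕ 4 ⁻¹) + ε) * Y                 ∎
    where
    e = 4 ℕ.+ e′
    d = 4 ℕ.* e
    y = q ℕ.^ ℕ.suc e′
    E = fromℕ e
    Y = fromℕ y
    x = Y ⁻¹
    instance
      y≢0 : NonZero y
      y≢0 = ℕ.m^n≢0 q (ℕ.suc e′)
      q^e≢0 : NonZero (q ℕ.^ (ℕ.suc e′ ℕ.* d))
      q^e≢0 = ℕ.m^n≢0 q (ℕ.suc e′ ℕ.* d)
    nonzero : ∀ {z} → 0# < z → ¬ (z ≈ 0#)
    nonzero (_ , 0≉z) z≈0 = 0≉z (sym z≈0)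
    xY≈1 : x * Y ≈ 1#
    xY≈1 = trans (*-comm x Y) (*-inverseʳ Y (nonzero (0<fromℕ y)))
    0≤x : 0# ≤ x
    0≤x = 0≤⁻¹ (0<fromℕ y)

    n^e≤ : n ℕ.^ e ℕ.≤ n ℕ.^ 4 ℕ.* y ℕ.^ d
    n^e≤ = ℕ.≤-trans (ℕ.≤-reflexive (ℕ.^-distribˡ-+-* n 4 e′)) (ℕ.*-monoʳ-≤ (n ℕ.^ 4) (N.begin
      n ℕ.^ e′                          N.≤⟨ ℕ.^-monoˡ-≤ e′ n≤ ⟩
      (q ℕ.^ ℕ.suc d) ℕ.^ e′            N.≡⟨ ℕ.^-*-assoc q (ℕ.suc d) e′ ⟩
      q ℕ.^ (ℕ.suc d ℕ.* e′)            N.≤⟨ ℕ.^-monoʳ-≤ q exponent ⟩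
      q ℕ.^ (ℕ.suc e′ ℕ.* d)            N.≡⟨ ℕ.^-*-assoc q (ℕ.suc e′) d ⟨
      y ℕ.^ d                           N.∎))
      where
      module N = ℕ.≤-Reasoning
      -- Using n ≤ q^(d+1) rather than q^d costs an excess of `e′` in the exponent, which the extra
      -- `d` on the right covers, as e′ ≤ e ≤ 4e = d.
      exponent : ℕ.suc d ℕ.* e′ ℕ.≤ ℕ.suc e′ ℕ.* d
      exponent = ℕ.+-mono-≤ (ℕ.≤-trans (ℕ.m≤n+m e′ 4) (ℕ.m≤n*m e 4)) (ℕ.≤-reflexive (ℕ.*-comm d e′))

    x≤α : x ≤ n ^ʳ (- (fromℕ 4 ⁻¹) + ε)
    x≤α = proj₁ (proj₂ (belowPower-supremum _ (- (fromℕ 4 ⁻¹) + ε)))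
      -- The rational exponent is (4 - e)/d = -1/4 + 1/e; the denominator is passed as its
      -- predecessor. Being in the set, `x` lies below the supremum.
      (0≤x , 4 , e , ℕ.pred d , exponent , powers)
      where
      exponent : fromℕ 4 ≤ E + (- (fromℕ 4 ⁻¹) + ε) * fromℕ d
      exponent = begin
        fromℕ 4                         ≈⟨ *-identityʳ (fromℕ 4) ⟨
        fromℕ 4 * 1#                    ≤⟨ *-monoʳ-≤ (0≤fromℕ 4) 1≤eε ⟩
        fromℕ 4 * (E * ε)               ≈⟨ *-assoc (fromℕ 4) E ε ⟨
        fromℕ 4 * E * ε                 ≈⟨ *-congʳ (fromℕ-* 4 e) ⟨
        fromℕ d * ε                     ≈⟨ *-comm (fromℕ d) ε ⟩
        ε * fromℕ d                     ≈⟨ +-identityˡ (ε * fromℕ d) ⟨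
        0# + ε * fromℕ d                ≈⟨ +-congʳ (-‿inverseʳ E) ⟨
        E - E + ε * fromℕ d             ≈⟨ +-assoc E (- E) (ε * fromℕ d) ⟩
        E + (- E + ε * fromℕ d)         ≈⟨ +-congˡ (+-congʳ quarter) ⟨
        E + (- (fromℕ 4 ⁻¹) * fromℕ d + ε * fromℕ d)
                                        ≈⟨ +-congˡ (distribʳ (fromℕ d) (- (fromℕ 4 ⁻¹)) ε) ⟨
        E + (- (fromℕ 4 ⁻¹) + ε) * fromℕ d ∎
        where
        quarter : - (fromℕ 4 ⁻¹) * fromℕ d ≈ - E
        quarter = begin-equality
          - (fromℕ 4 ⁻¹) * fromℕ d         ≈⟨ -‿distribˡ-* (fromℕ 4 ⁻¹) (fromℕ d) ⟨
          - (fromℕ 4 ⁻¹ * fromℕ d)         ≈⟨ -‿cong (*-congˡ (fromℕ-* 4 e)) ⟩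
          - (fromℕ 4 ⁻¹ * (fromℕ 4 * E))   ≈⟨ -‿cong (*-assoc (fromℕ 4 ⁻¹) (fromℕ 4) E) ⟨
          - (fromℕ 4 ⁻¹ * fromℕ 4 * E)     ≈⟨ -‿cong (*-congʳ (trans (*-comm (fromℕ 4 ⁻¹) (fromℕ 4))
                                                (*-inverseʳ (fromℕ 4) (nonzero (0<fromℕ 4))))) ⟩
          - (1# * E)                       ≈⟨ -‿cong (*-identityˡ E) ⟩
          - E                              ∎
      powers : x ^ d * fromℕ n ^ e ≤ fromℕ n ^ 4
      powers = begin
        x ^ d * fromℕ n ^ e                        ≈⟨ *-congˡ (fromℕ-^ n e) ⟨
        x ^ d * fromℕ (n ℕ.^ e)                    ≤⟨ *-monoʳ-≤ (0≤^ d) (fromℕ-mono-≤ n^e≤) ⟩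
        x ^ d * fromℕ (n ℕ.^ 4 ℕ.* y ℕ.^ d)        ≈⟨ *-congˡ (fromℕ-* (n ℕ.^ 4) (y ℕ.^ d)) ⟩
        x ^ d * (fromℕ (n ℕ.^ 4) * fromℕ (y ℕ.^ d))
          ≈⟨ *-congˡ (*-cong (fromℕ-^ n 4) (fromℕ-^ y d)) ⟩
        x ^ d * (fromℕ n ^ 4 * Y ^ d)
          ≈⟨ solve 3 (λ a b c → a :* (b :* c) := b :* (a :* c)) refl (x ^ d) (fromℕ n ^ 4) (Y ^ d) ⟩
        fromℕ n ^ 4 * (x ^ d * Y ^ d)              ≈⟨ *-congˡ (^-distrib-* x Y d) ⟨
        fromℕ n ^ 4 * (x * Y) ^ d                  ≈⟨ *-congˡ (^-congˡ d xY≈1) ⟩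
        fromℕ n ^ 4 * 1# ^ d                       ≈⟨ *-congˡ (1^ d) ⟩
        fromℕ n ^ 4 * 1#                           ≈⟨ *-identityʳ (fromℕ n ^ 4) ⟩
        fromℕ n ^ 4                                ∎
        where
        0≤^ : ∀ d → 0# ≤ x ^ d
        0≤^ ℕ.zero    = 0≤1
        0≤^ (ℕ.suc d) = *-nonneg 0≤x (0≤^ d)
        1^ : ∀ d → 1# ^ d ≈ 1#
        1^ ℕ.zero    = refl
        1^ (ℕ.suc d) = trans (*-identityˡ (1# ^ d)) (1^ d)

-- Finite sums, averaging and independent sampling.

module Sums (𝓡 : CompleteOrderedField) where
  open import Data.Bool.Base using (true; false)
  open import Data.Empty using (⊥-elim)
  open import Data.List.Base as List using (List; []; _∷_; length)
  open import Data.List.Membership.Propositional using (_∈_)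
  open import Data.List.Relation.Unary.Any using (here; there)
  import Data.Nat.Properties as ℕ
  open import Data.Vec.Base as Vec using (Vec; []; _∷_)
  open import Data.Vec.Relation.Unary.Any using (any?)
  open import Function.Base using (_∘_)
  open import Level using (Level)
  import Relation.Binary.PropositionalEquality.Core as ≡
  open import Relation.Nullary using (does)
  open import Relation.Unary using (Pred; Decidable)
  open CompleteOrderedField 𝓡
  open FieldProperties 𝓡
  open Optimization 𝓡 using (∑)
  open Solver using (solve; _:=_; _:+_; _:*_)

  private
    variable
      a p : Level
      A B C : Set a

  ∑-cong : ∀ (xs : List A) {f g} → (∀ x → f x ≈ g x) → ∑ xs f ≈ ∑ xs g
  ∑-cong []       f≈g = refl
  ∑-cong (x ∷ xs) f≈g = +-cong (f≈g x) (∑-cong xs f≈g)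

  ∑-mono : ∀ (xs : List A) {f g} → (∀ x → f x ≤ g x) → ∑ xs f ≤ ∑ xs g
  ∑-mono []       f≤g = ≤-refl
  ∑-mono (x ∷ xs) f≤g = +-mono-≤ (f≤g x) (∑-mono xs f≤g)

  ∑-0 : ∀ (xs : List A) → ∑ xs (λ _ → 0#) ≈ 0#
  ∑-0 []       = refl
  ∑-0 (x ∷ xs) = trans (+-identityˡ _) (∑-0 xs)

  ∑-+ : ∀ (xs : List A) f g → ∑ xs (λ x → f x + g x) ≈ ∑ xs f + ∑ xs g
  ∑-+ []       f g = sym (+-identityˡ 0#)
  ∑-+ (x ∷ xs) f g = trans (+-congˡ (∑-+ xs f g))
    (solve 4 (λ a b c d → a :+ b :+ (c :+ d) := a :+ c :+ (b :+ d)) refl (f x) (g x) (∑ xs f) (∑ xs g))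

  ∑-*ˡ : ∀ (xs : List A) c f → ∑ xs (λ x → c * f x) ≈ c * ∑ xs f
  ∑-*ˡ []       c f = sym (zeroʳ c)
  ∑-*ˡ (x ∷ xs) c f = trans (+-congˡ (∑-*ˡ xs c f)) (sym (distribˡ c (f x) (∑ xs f)))

  ∑-*ʳ : ∀ (xs : List A) c f → ∑ xs (λ x → f x * c) ≈ ∑ xs f * c
  ∑-*ʳ xs c f = trans (∑-cong xs (λ x → *-comm (f x) c)) (trans (∑-*ˡ xs c f) (*-comm c (∑ xs f)))

  ∑-const : ∀ (xs : List A) c → ∑ xs (λ _ → c) ≈ fromℕ (length xs) * c
  ∑-const []       c = sym (zeroˡ c)
  ∑-const (x ∷ xs) c = trans (+-cong (sym (*-identityˡ c)) (∑-const xs c))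
                         (sym (distribʳ c 1# (fromℕ (length xs))))

  ∑-swap : ∀ (xs : List A) (ys : List B) (f : A → B → Carrier) →
           ∑ xs (λ x → ∑ ys (f x)) ≈ ∑ ys (λ y → ∑ xs (λ x → f x y))
  ∑-swap []       ys f = sym (∑-0 ys)
  ∑-swap (x ∷ xs) ys f = trans (+-congˡ (∑-swap xs ys f)) (sym (∑-+ ys (f x) (λ y → ∑ xs (λ x → f x y))))

  ∑-++ : ∀ (xs ys : List A) f → ∑ (xs List.++ ys) f ≈ ∑ xs f + ∑ ys f
  ∑-++ []       ys f = sym (+-identityˡ _)
  ∑-++ (x ∷ xs) ys f = trans (+-congˡ (∑-++ xs ys f)) (sym (+-assoc (f x) (∑ xs f) (∑ ys f)))

  ∑-map : ∀ (xs : List A) (g : A → B) f → ∑ (List.map g xs) f ≈ ∑ xs (f ∘ g)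
  ∑-map []       g f = refl
  ∑-map (x ∷ xs) g f = +-congˡ (∑-map xs g f)

  ∑-cartesianProductWith : ∀ (g : A → B → C) xs ys f →
    ∑ (List.cartesianProductWith g xs ys) f ≈ ∑ xs (λ x → ∑ ys (λ y → f (g x y)))
  ∑-cartesianProductWith g []       ys f = refl
  ∑-cartesianProductWith g (x ∷ xs) ys f =
    trans (∑-++ (List.map (g x) ys) _ f) (+-cong (∑-map ys (g x) f) (∑-cartesianProductWith g xs ys f))

  ∑-fromℕ : ∀ (xs : List A) f → ∑ xs (λ x → fromℕ (f x)) ≈ fromℕ (sumOver xs f)
  ∑-fromℕ []       f = refl
  ∑-fromℕ (x ∷ xs) f = trans (+-congˡ (∑-fromℕ xs f)) (sym (fromℕ-+ (f x) (sumOver xs f)))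

  ∑-filter : ∀ {P : Pred A p} (P? : Decidable P) xs f →
             ∑ (List.filter P? xs) f ≈ ∑ xs (λ x → fromℕ (indicator (P? x)) * f x)
  ∑-filter P? []       f = refl
  ∑-filter P? (x ∷ xs) f with does (P? x)
  ... | true  = +-cong (sym (trans (*-congʳ fromℕ-1) (*-identityˡ (f x)))) (∑-filter P? xs f)
  ... | false = trans (∑-filter P? xs f) (sym (trans (+-congʳ (zeroˡ (f x))) (+-identityˡ _)))

  -- The first-moment method: a head whose value exceeds `c` is dropped, and the average of the rest
  -- still is at most `c`. The membership of `x₀` excludes the empty list.
  ∑-average : ∀ {x₀} (xs : List A) f c → x₀ ∈ xs → ∑ xs f ≤ fromℕ (length xs) * c →
              ∃ λ x → x ∈ xs × f x ≤ c
  ∑-average {A = A} (x ∷ xs) f c _ = go x xs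
    where
    go : ∀ x (ys : List A) → ∑ (x ∷ ys) f ≤ fromℕ (length (x ∷ ys)) * c →
         ∃ λ z → z ∈ x ∷ ys × f z ≤ c
    go x ys h with f x ≤? c
    go x ys h | yes fx≤c = x , here ≡.refl , fx≤c
    go x [] h | no fx≰c = ⊥-elim (fx≰c (begin
      f x            ≈⟨ +-identityʳ (f x) ⟨
      f x + 0#       ≤⟨ h ⟩
      fromℕ 1 * c    ≈⟨ trans (*-congʳ fromℕ-1) (*-identityˡ c) ⟩
      c              ∎))
    go x (y ∷ ys) h | no fx≰c
      with z , z∈ , fz≤c ← go y ys (+-cancelʳ-≤ c (begin
        ∑ (y ∷ ys) f + c                       ≤⟨ +-monoʳ-≤ (∑ (y ∷ ys) f) (≰⇒≥ fx≰c) ⟩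
        ∑ (y ∷ ys) f + f x                     ≈⟨ +-comm (∑ (y ∷ ys) f) (f x) ⟩
        ∑ (x ∷ y ∷ ys) f                       ≤⟨ h ⟩
        (1# + fromℕ (length (y ∷ ys))) * c     ≈⟨ distribʳ c 1# (fromℕ (length (y ∷ ys))) ⟩
        1# * c + fromℕ (length (y ∷ ys)) * c   ≈⟨ +-congʳ (*-identityˡ c) ⟩
        c + fromℕ (length (y ∷ ys)) * c        ≈⟨ +-comm c _ ⟩
        fromℕ (length (y ∷ ys)) * c + c        ∎))
      = z , there z∈ , fz≤c

  module Sampling {A : Set a} (xs : List A) (w : A → Carrier)
                  (w≥0 : ∀ x → 0# ≤ w x) (w-total : ∑ xs w ≈ 1#) where

    -- The product measure, written exactly as the summand of `Pr`.
    Π : ∀ {m} → Vec A m → Carrier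
    Π v = Vec.foldr′ _*_ 1# (Vec.map w v)

    Π≥0 : ∀ {m} (v : Vec A m) → 0# ≤ Π v
    Π≥0 []      = 0≤1
    Π≥0 (x ∷ v) = *-nonneg (w≥0 x) (Π≥0 v)

    Π-total : ∀ m → ∑ (vectors xs m) Π ≈ 1#
    Π-total ℕ.zero    = +-identityʳ 1#
    Π-total (ℕ.suc m) = begin-equality
      ∑ (vectors xs (ℕ.suc m)) Π
        ≈⟨ ∑-cartesianProductWith _∷_ xs (vectors xs m) Π ⟩
      ∑ xs (λ x → ∑ (vectors xs m) (λ v → w x * Π v))
        ≈⟨ ∑-cong xs (λ x → trans (∑-*ˡ (vectors xs m) (w x) Π)
                              (trans (*-congˡ (Π-total m)) (*-identityʳ (w x)))) ⟩
      ∑ xs w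
        ≈⟨ w-total ⟩
      1# ∎

    -- Indicators are subadditive in the first draw and the remaining ones; the weights of the draws
    -- not concerned sum to 1.
    union-bound : ∀ {P : Pred A p} (P? : Decidable P) m →
      ∑ (vectors xs m) (λ v → Π v * fromℕ (indicator (any? P? v))) ≤
      fromℕ m * ∑ xs (λ x → w x * fromℕ (indicator (P? x)))
    union-bound P? ℕ.zero    = ≤-reflexive (trans (+-identityʳ _) (trans (zeroʳ 1#) (sym (zeroˡ _))))
    union-bound P? (ℕ.suc m) = begin
      ∑ (vectors xs (ℕ.suc m)) (λ v → Π v * fromℕ (indicator (any? P? v)))
        ≈⟨ ∑-cartesianProductWith _∷_ xs (vectors xs m) _ ⟩
      ∑ xs (λ x → ∑ (vectors xs m) (λ v → w x * Π v * fromℕ (indicator (any? P? (x ∷ v)))))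
        ≤⟨ ∑-mono xs (λ x → ∑-mono (vectors xs m) (λ v → begin
             w x * Π v * fromℕ (indicator (any? P? (x ∷ v)))
               ≤⟨ *-monoʳ-≤ (*-nonneg (w≥0 x) (Π≥0 v)) (begin
                    fromℕ (indicator (any? P? (x ∷ v)))   ≤⟨ fromℕ-mono-≤ (indicator-∷ x v) ⟩
                    fromℕ (one x ℕ.+ any v)               ≈⟨ fromℕ-+ (one x) (any v) ⟩
                    fromℕ (one x) + fromℕ (any v)         ∎) ⟩
             w x * Π v * (fromℕ (one x) + fromℕ (any v))
               ≈⟨ solve 4 (λ w W s t → w :* W :* (s :+ t) := w :* s :* W :+ w :* (W :* t)) refl
                    (w x) (Π v) (fromℕ (one x)) (fromℕ (any v)) ⟩
             w x * fromℕ (one x) * Π v + w x * (Π v * fromℕ (any v)) ∎)) ⟩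
      ∑ xs (λ x → ∑ (vectors xs m) (λ v → w x * fromℕ (one x) * Π v + w x * (Π v * fromℕ (any v))))
        ≈⟨ ∑-cong xs (λ x → trans (∑-+ (vectors xs m) _ _) (+-cong
             (trans (∑-*ˡ (vectors xs m) (w x * fromℕ (one x)) Π)
               (trans (*-congˡ (Π-total m)) (*-identityʳ _)))
             (∑-*ˡ (vectors xs m) (w x) _))) ⟩
      ∑ xs (λ x → w x * fromℕ (one x) + w x * rest)
        ≈⟨ trans (∑-+ xs _ _) (+-congˡ
             (trans (∑-*ʳ xs rest w) (trans (*-congʳ w-total) (*-identityˡ rest)))) ⟩
      single + rest
        ≤⟨ +-monoʳ-≤ single (union-bound P? m) ⟩
      single + fromℕ m * single
        ≈⟨ +-congʳ (*-identityˡ single) ⟨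
      1# * single + fromℕ m * single
        ≈⟨ distribʳ single 1# (fromℕ m) ⟨
      fromℕ (ℕ.suc m) * single ∎
      where
      one = λ x → indicator (P? x)
      any : Vec A m → ℕ
      any v = indicator (any? P? v)
      rest = ∑ (vectors xs m) (λ v → Π v * fromℕ (any v))
      single = ∑ xs (λ x → w x * fromℕ (one x))
      indicator-∷ : ∀ x (v : Vec A m) → indicator (any? P? (x ∷ v)) ℕ.≤ one x ℕ.+ any v
      indicator-∷ x v with does (P? x)
      ... | true  = ℕ.s≤s ℕ.z≤n
      ... | false = ℕ.≤-refl

-- The hard functions and the envelope they share.

module HardFunctions where
  open import Data.Fin.Subset
  open import Data.Fin.Subset.Properties using (∩-assoc; ∩-idem; ∣p∩q∣≤∣p∣)
  open import Data.List.Base using (length; allFin)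
  open import Data.List.Properties using (length-tabulate)
  open import Data.Nat.Base
  open import Data.Nat.Properties
  open import Data.Nat.Solver using (module +-*-Solver)
  open import Data.Fin.Base using (Fin)
  open import Relation.Binary.PropositionalEquality.Core using (_≡_; refl; sym; trans; cong; cong₂)
  open +-*-Solver using (solve; _:=_; _:+_; _:*_)
  open ≤-Reasoning

  module Hiding {n} (θ k t : ℕ) (T : Subset n) where
    -- `C` is the region of the good group. Its part `T ∩ C` counts in full, while the rest of the
    -- hidden set counts for at most `t` elements.
    module Hard (C : Subset n) = Truncation (k * θ) (θ * t)
      (modular-+ (modular-* θ (modular-∩ (T ∩ C))) (modular-* k modular-∣∣))
      (modular-* θ (modular-∩ (T ∩ ∁ C)))

    hard : Subset n → Subset n → ℕ
    hard = Hard.truncated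

    -- With the inner cap inactive, the good and the bad part recombine to `S ∩ T`, and `C`
    -- disappears from the formula.
    envelope : Subset n → ℕ
    envelope S = k * θ ⊓ (θ * ∣ S ∩ T ∣ + k * ∣ S ∣)

    -- If |S| ≥ θ, the term `k * ∣ S ∣` alone fills the outer cap on both sides. Otherwise |S ∩ T| ≤
    -- t, so the inner cap is inactive.
    hard≡envelope : ∀ C S → ¬ Exposed θ t T S → hard C S ≡ envelope S
    hard≡envelope C S ¬exposed with ∣ S ∣ <? θ
    ... | no s≮θ = trans (saturated (≤-trans kθ≤ks (≤-trans (m≤n+m _ (θ * ∣ S ∩ (T ∩ C) ∣)) (m≤m+n _ _))))
                         (sym (saturated (≤-trans kθ≤ks (m≤n+m _ _))))
      where
      saturated : ∀ {x} → k * θ ≤ x → k * θ ⊓ x ≡ k * θ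
      saturated = m≤n⇒m⊓n≡m
      kθ≤ks : k * θ ≤ k * ∣ S ∣
      kθ≤ks = *-monoʳ-≤ k (≮⇒≥ s≮θ)
    ... | yes s<θ = cong (k * θ ⊓_) (begin-equality
      θ * ∣ S ∩ (T ∩ C) ∣ + k * ∣ S ∣ + θ * t ⊓ (θ * ∣ S ∩ (T ∩ ∁ C) ∣)
        ≡⟨ cong (θ * ∣ S ∩ (T ∩ C) ∣ + k * ∣ S ∣ +_) (m≥n⇒m⊓n≡n (*-monoʳ-≤ θ (≤-trans
             (≤-trans (≤-reflexive (cong ∣_∣ (sym (∩-assoc S T (∁ C))))) (∣p∩q∣≤∣p∣ (S ∩ T) (∁ C)))
             (≮⇒≥ (λ t< → ¬exposed (s<θ , t<)))))) ⟩
      θ * ∣ S ∩ (T ∩ C) ∣ + k * ∣ S ∣ + θ * ∣ S ∩ (T ∩ ∁ C) ∣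
        ≡⟨ solve 4 (λ h x y z → h :* x :+ y :+ h :* z := h :* (x :+ z) :+ y) refl
             θ (∣ S ∩ (T ∩ C) ∣) (k * ∣ S ∣) (∣ S ∩ (T ∩ ∁ C) ∣) ⟩
      θ * (∣ S ∩ (T ∩ C) ∣ + ∣ S ∩ (T ∩ ∁ C) ∣) + k * ∣ S ∣
        ≡⟨ cong (λ z → θ * z + k * ∣ S ∣) (trans
             (cong₂ _+_ (cong ∣_∣ (sym (∩-assoc S T C))) (cong ∣_∣ (sym (∩-assoc S T (∁ C)))))
             (∣p∩q∣+∣p∩∁q∣≡∣p∣ (S ∩ T) C)) ⟩
      θ * ∣ S ∩ T ∣ + k * ∣ S ∣ ∎)

    hard-optimum : ∀ C → ∣ T ∩ C ∣ ≡ k → hard C (T ∩ C) ≡ k * θ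
    hard-optimum C TC≡k = m≤n⇒m⊓n≡m (begin
      k * θ                         ≡⟨ *-comm k θ ⟩
      θ * k                         ≡⟨ cong (θ *_) TC≡k ⟨
      θ * ∣ T ∩ C ∣                 ≡⟨ cong (λ A → θ * ∣ A ∣) (∩-idem (T ∩ C)) ⟨
      θ * ∣ (T ∩ C) ∩ (T ∩ C) ∣     ≤⟨ ≤-trans (m≤m+n _ _) (m≤m+n _ _) ⟩
      _                             ∎)

    -- The at most `k` elements of `S ∩ T` are shared among the disjoint groups, which gives θk in
    -- total. Each of the `r` functions receives in addition at most k² from the linear term and θt
    -- from the inner cap.
    hard-sum : ∀ {r} (C : Fin r → Subset n) →
      (∀ P → sumOver (allFin r) (λ i → ∣ P ∩ C i ∣) ≤ ∣ P ∣) →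
      ∀ S → ∣ S ∣ ≤ k → sumOver (allFin r) (λ i → hard (C i) S) ≤ θ * k + r * (k * k + θ * t)
    hard-sum {r} C disjoint S s≤k = begin
      sumOver (allFin r) (λ i → hard (C i) S)
        ≤⟨ sumOver-mono (allFin r) (λ i → begin
             hard (C i) S
               ≤⟨ m⊓n≤n (k * θ) _ ⟩
             θ * ∣ S ∩ (T ∩ C i) ∣ + k * ∣ S ∣ + θ * t ⊓ (θ * ∣ S ∩ (T ∩ ∁ (C i)) ∣)
               ≤⟨ +-mono-≤ (+-monoʳ-≤ (θ * ∣ S ∩ (T ∩ C i) ∣) (*-monoʳ-≤ k s≤k)) (m⊓n≤m (θ * t) _) ⟩
             θ * ∣ S ∩ (T ∩ C i) ∣ + k * k + θ * t
               ≡⟨ trans (+-assoc _ (k * k) (θ * t))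
                    (cong (λ A → θ * ∣ A ∣ + (k * k + θ * t)) (sym (∩-assoc S T (C i)))) ⟩
             θ * ∣ (S ∩ T) ∩ C i ∣ + (k * k + θ * t) ∎) ⟩
      sumOver (allFin r) (λ i → θ * ∣ (S ∩ T) ∩ C i ∣ + (k * k + θ * t))
        ≡⟨ sumOver-+const (allFin r) (λ i → θ * ∣ (S ∩ T) ∩ C i ∣) (k * k + θ * t) ⟩
      sumOver (allFin r) (λ i → θ * ∣ (S ∩ T) ∩ C i ∣) + length (allFin r) * (k * k + θ * t)
        ≡⟨ cong₂ (λ a l → a + l * (k * k + θ * t)) (sumOver-*ˡ (allFin r) θ _)
             (length-tabulate {n = r} (λ i → i)) ⟩
      θ * sumOver (allFin r) (λ i → ∣ (S ∩ T) ∩ C i ∣) + r * (k * k + θ * t)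
        ≤⟨ +-monoˡ-≤ _ (*-monoʳ-≤ θ (≤-trans (disjoint (S ∩ T)) (≤-trans (∣p∩q∣≤∣p∣ S T) s≤k))) ⟩
      θ * k + r * (k * k + θ * t) ∎

-- Indistinguishable functions and the resulting bound for any optimizer.

module Indistinguishability (𝓡 : CompleteOrderedField) where
  open import Data.Bool.Base using (true; false)
  open import Data.Fin.Base using (Fin)
  open import Data.Fin.Subset using (Subset; _⊆_; _∩_; _∪_; ⁅_⁆; ∣_∣)
  open import Data.Fin.Subset.Properties using (p⊆p∪q)
  open import Data.List.Base using (List; []; _∷_; length; allFin)
  import Data.List.Extrema
  open import Data.List.Membership.Propositional using (_∈_)
  open import Data.List.Membership.Propositional.Properties
    using (∈-map⁺; ∈-filter⁺; ∈-cartesianProductWith⁺)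
  open import Data.List.Properties using (length-tabulate)
  import Data.List.Relation.Unary.All as All
  open import Data.List.Relation.Unary.Any using (here; there)
  import Data.Nat.Properties as ℕ
  open import Data.Vec.Base using (Vec; []; _∷_)
  open import Data.Vec.Relation.Binary.Pointwise.Inductive using (Pointwise; []; _∷_)
  open import Data.Vec.Relation.Unary.Any as Any using (Any; any?)
  open import Function.Base using (_∘_)
  import Relation.Binary.PropositionalEquality.Core as ≡
  open import Relation.Nullary using (Dec)
  open CompleteOrderedField 𝓡
  open FieldProperties 𝓡
  open Sums 𝓡
  open Optimization 𝓡
  open Data.List.Extrema totalOrder using (xs≤max)
  open Solver using (solve; _:=_; _:+_; _:*_)

  ∈-subsets : ∀ {n} (S : Subset n) → S ∈ subsets n
  ∈-subsets []      = here ≡.refl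
  ∈-subsets (s ∷ S) = ∈-cartesianProductWith⁺ _∷_ (∈-sides s) (∈-subsets S)
    where
    ∈-sides : ∀ s → s ∈ false ∷ true ∷ []
    ∈-sides false = here ≡.refl
    ∈-sides true  = there (here ≡.refl)

  ≤-maxFeasible : ∀ {n} k (f : SetFunction n) S → ∣ S ∣ ℕ.≤ k → f S ≤ maxFeasible k f
  ≤-maxFeasible k f S S≤k = All.lookup (xs≤max _ _)
    (∈-map⁺ f (∈-filter⁺ (λ T → ∣ T ∣ ℕ.≤? k) (∈-subsets S) S≤k))

  fromℕ-monotoneSubmodular : ∀ {n} (f : Subset n → ℕ) →
    (∀ S e → f S ℕ.≤ f (S ∪ ⁅ e ⁆)) →
    (∀ S T e → S ⊆ T → f (T ∪ ⁅ e ⁆) ℕ.+ f S ℕ.≤ f (S ∪ ⁅ e ⁆) ℕ.+ f T) →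
    NonnegativeMonotoneSubmodular (fromℕ ∘ f)
  fromℕ-monotoneSubmodular f mono submod =
    (λ S → 0≤fromℕ (f S)) , (λ S e → fromℕ-mono-≤ (mono S e)) , λ S T e S⊆T → -‿mono-≤ (begin
      fromℕ (f (T ∪ ⁅ e ⁆)) + fromℕ (f S)   ≈⟨ fromℕ-+ (f (T ∪ ⁅ e ⁆)) (f S) ⟨
      fromℕ (f (T ∪ ⁅ e ⁆) ℕ.+ f S)         ≤⟨ fromℕ-mono-≤ (submod S T e S⊆T) ⟩
      fromℕ (f (S ∪ ⁅ e ⁆) ℕ.+ f T)         ≈⟨ fromℕ-+ (f (S ∪ ⁅ e ⁆)) (f T) ⟩
      fromℕ (f (S ∪ ⁅ e ⁆)) + fromℕ (f T)   ∎)

  -- The bound on `f` is asked on the support only, since the feasibility of an algorithm is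
  -- expressed by vanishing weights.
  𝔼-≤ : ∀ {n} (O : Distribution n) (f : SetFunction n) c →
        (∀ S → ¬ (weight O S ≈ 0#) → f S ≤ c) → 𝔼 O f ≤ c
  𝔼-≤ {n} O f c f≤c = begin
    𝔼 O f                               ≤⟨ ∑-mono (subsets n) pointwise ⟩
    ∑ (subsets n) (λ S → weight O S * c) ≈⟨ ∑-*ʳ (subsets n) c (weight O) ⟩
    ∑ (subsets n) (weight O) * c         ≈⟨ trans (*-congʳ (total-weight O)) (*-identityˡ c) ⟩
    c                                    ∎
    where
    pointwise : ∀ S → weight O S * f S ≤ weight O S * c
    pointwise S with weight O S ≟ 0#
    ... | yes w≈0 = ≤-reflexive (trans (vanish (f S)) (sym (vanish c)))
      where
      vanish : ∀ x → weight O S * x ≈ 0#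
      vanish x = trans (*-congʳ w≈0) (zeroˡ x)
    ... | no  w≉0 = *-monoʳ-≤ (nonnegative O S) (f≤c S w≉0)

  ∑-𝔼 : ∀ {n} {I : Set} (is : List I) (O : Distribution n) (f : I → Subset n → ℕ) →
        ∑ is (λ i → 𝔼 O (fromℕ ∘ f i)) ≈ 𝔼 O (λ S → fromℕ (sumOver is (λ i → f i S)))
  ∑-𝔼 {n} is O f = trans (∑-swap is (subsets n) (λ i S → weight O S * fromℕ (f i S)))
    (∑-cong (subsets n) (λ S → trans (∑-*ˡ is (weight O S) (λ i → fromℕ (f i S)))
      (*-congˡ (∑-fromℕ is (λ i → f i S)))))

  labelled-cong : ∀ {n m} {f g : SetFunction n} (Ss : Vec (Subset n) m) {P : Subset n → Set} →
    (∀ S → ¬ P S → f S ≈ g S) → ¬ Any P Ss →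
    Pointwise (λ x y → (proj₁ x ≡.≡ proj₁ y) × (proj₂ x ≈ proj₂ y)) (labelled f Ss) (labelled g Ss)
  labelled-cong []       f≈g ¬any = []
  labelled-cong (S ∷ Ss) f≈g ¬any =
    (≡.refl , f≈g S (¬any ∘ Any.here)) ∷ labelled-cong Ss f≈g (¬any ∘ Any.there)

  -- `exposed-rare` fixes `S` and averages over `T`. Exchanging the sums gives the same bound for
  -- the mean over `T` of the exposure probability under `D`, so some `T`, chosen in view of `D`
  -- alone, attains it.
  hidden-set-exists : ∀ {n r k b θ t} .{{_ : NonZero b}} → 2 ℕ.* θ ℕ.≤ b →
    (hidden : HiddenPartitions n r k b) (D : Distribution n) →
    ∃ λ T → T ∈ HiddenPartitions.family hidden ×
            fromℕ (2 ℕ.^ t) * ∑ (subsets n) (λ S → weight D S * fromℕ (indicator (exposed? θ t T S))) ≤ 1#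
  hidden-set-exists {n} {θ = θ} {t} 2θ≤b hidden D =
    ∑-average family _ 1# (proj₂ inhabited) (begin
      ∑ family (λ T → 2ᵗ * ∑ (subsets n) (λ S → weight D S * e T S))
        ≈⟨ ∑-*ˡ family 2ᵗ _ ⟩
      2ᵗ * ∑ family (λ T → ∑ (subsets n) (λ S → weight D S * e T S))
        ≈⟨ *-congˡ (∑-swap family (subsets n) _) ⟩
      2ᵗ * ∑ (subsets n) (λ S → ∑ family (λ T → weight D S * e T S))
        ≈⟨ ∑-*ˡ (subsets n) 2ᵗ _ ⟨
      ∑ (subsets n) (λ S → 2ᵗ * ∑ family (λ T → weight D S * e T S))
        ≤⟨ ∑-mono (subsets n) (λ S → begin
             2ᵗ * ∑ family (λ T → weight D S * e T S)
               ≈⟨ *-congˡ (trans (∑-*ˡ family (weight D S) (λ T → e T S)) (*-congˡ (∑-fromℕ family _))) ⟩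
             2ᵗ * (weight D S * fromℕ (count S))
               ≈⟨ solve 3 (λ a b c → a :* (b :* c) := b :* (a :* c)) refl 2ᵗ (weight D S) (fromℕ (count S)) ⟩
             weight D S * (2ᵗ * fromℕ (count S))
               ≈⟨ *-congˡ (fromℕ-* (2 ℕ.^ t) (count S)) ⟨
             weight D S * fromℕ (2 ℕ.^ t ℕ.* count S)
               ≤⟨ *-monoʳ-≤ (nonnegative D S) (fromℕ-mono-≤ (exposed-rare {θ = θ} {t} 2θ≤b spread S)) ⟩
             weight D S * fromℕ (length family) ∎) ⟩
      ∑ (subsets n) (λ S → weight D S * fromℕ (length family))
        ≈⟨ ∑-*ʳ (subsets n) _ (weight D) ⟩
      ∑ (subsets n) (weight D) * fromℕ (length family)
        ≈⟨ trans (*-congʳ (total-weight D)) (*-comm 1# _) ⟩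
      fromℕ (length family) * 1# ∎)
    where
    open HiddenPartitions hidden
    2ᵗ = fromℕ (2 ℕ.^ t)
    e : Subset n → Subset n → Carrier
    e T S = fromℕ (indicator (exposed? θ t T S))
    count : Subset n → ℕ
    count S = sumOver family (λ T → indicator (exposed? θ t T S))

  module _ {n r k b θ t m : ℕ} (hidden : HiddenPartitions n r k b)
           {T : Subset n} (T∈ : T ∈ HiddenPartitions.family hidden)
           (D : Distribution n) (𝒜 : Algorithm n m k) where
    open HiddenPartitions hidden
    open HardFunctions.Hiding θ k t T
    open Sampling (subsets n) (weight D) (nonnegative D) (total-weight D)

    f : Fin r → SetFunction n
    f i = fromℕ ∘ hard (parts i)

    f∈𝓕 : ∀ i → NonnegativeMonotoneSubmodular (f i)
    f∈𝓕 i = fromℕ-monotoneSubmodular (hard (parts i))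
      (λ S e → truncated-monotone {S} (p⊆p∪q ⁅ e ⁆)) (λ S T e → truncated-submodular e)
      where open Hard (parts i)

    exposure : Vec (Subset n) m → Carrier
    exposure Ss = fromℕ (indicator (any? (exposed? θ t T) Ss))

    -- A fictitious run on the labels of the envelope, common to all groups. On unexposed samples
    -- its output distribution agrees with that of the run on every `f i`.
    blind : Vec (Subset n) m → Distribution n
    blind Ss = run 𝒜 (labelled (fromℕ ∘ envelope) Ss)

    U = fromℕ (θ ℕ.* k ℕ.+ r ℕ.* (k ℕ.* k ℕ.+ θ ℕ.* t))
    K = fromℕ (k ℕ.* θ)

    -- The output does not vary with `i`, so the sum over the groups moves inside the expectation,
    -- and `hard-sum` applies to each feasible set.
    blind-gain : ∀ Ss → ∑ (allFin r) (λ i → 𝔼 (blind Ss) (f i)) ≤ U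
    blind-gain Ss = begin
      ∑ (allFin r) (λ i → 𝔼 (blind Ss) (f i))
        ≈⟨ ∑-𝔼 (allFin r) (blind Ss) (λ i → hard (parts i)) ⟩
      𝔼 (blind Ss) (λ S → fromℕ (sumOver (allFin r) (λ i → hard (parts i) S)))
        ≤⟨ 𝔼-≤ (blind Ss) _ U (λ S w≉0 → fromℕ-mono-≤ (hard-sum parts disjoint S
             (ℕ.≮⇒≥ (λ k<s → w≉0 (feasible 𝒜 _ S k<s))))) ⟩
      U ∎

    module _ {α : Carrier} (0≤α : 0# ≤ α) where
      0≤αK : 0# ≤ α * K
      0≤αK = *-nonneg 0≤α (0≤fromℕ (k ℕ.* θ))

      Success : Fin r → Vec (Subset n) m → Set
      Success i Ss = α * maxFeasible k (f i) ≤ 𝔼 (run 𝒜 (labelled (f i) Ss)) (f i)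

      success? : ∀ i Ss → Dec (Success i Ss)
      success? i Ss = α * maxFeasible k (f i) ≤? 𝔼 (run 𝒜 (labelled (f i) Ss)) (f i)

      0≤𝔼 : ∀ (O : Distribution n) i → 0# ≤ 𝔼 O (f i)
      0≤𝔼 O i = ≤-trans (≤-reflexive (sym (∑-0 (subsets n))))
        (∑-mono (subsets n) (λ S → *-nonneg (nonnegative O S) (0≤fromℕ (hard (parts i) S))))

      -- A success on exposed samples is charged to the exposure. On unexposed samples the run is
      -- the blind one, so a success forces the blind value up to at least `α * K`, the set
      -- `T ∩ parts i` being feasible of value `K`.
      success-gain : ∀ i Ss → α * K * fromℕ (indicator (success? i Ss)) ≤
                              α * K * exposure Ss + 𝔼 (blind Ss) (f i)
      success-gain i Ss with success? i Ss | any? (exposed? θ t T) Ss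
      ... | no _  | d = begin
        α * K * 0#                                 ≈⟨ trans (zeroʳ (α * K)) (sym (+-identityʳ 0#)) ⟩
        0# + 0#                                    ≤⟨ +-mono-≤ (*-nonneg 0≤αK (0≤fromℕ (indicator d)))
                                                        (0≤𝔼 (blind Ss) i) ⟩
        α * K * fromℕ (indicator d) + 𝔼 (blind Ss) (f i) ∎
      ... | yes _ | yes _ = begin
        α * K * fromℕ 1                            ≈⟨ +-identityʳ _ ⟨
        α * K * fromℕ 1 + 0#                       ≤⟨ +-monoʳ-≤ _ (0≤𝔼 (blind Ss) i) ⟩
        α * K * fromℕ 1 + 𝔼 (blind Ss) (f i)       ∎
      ... | yes success | no unexposed = begin
        α * K * fromℕ 1
          ≈⟨ trans (*-congˡ fromℕ-1) (*-identityʳ (α * K)) ⟩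
        α * K
          ≤⟨ *-monoʳ-≤ 0≤α (≤-trans
               (≤-reflexive (reflexive (≡.cong fromℕ (≡.sym (hard-optimum (parts i) (part-card T∈ i))))))
               (≤-maxFeasible k (f i) (T ∩ parts i) (ℕ.≤-reflexive (part-card T∈ i)))) ⟩
        α * maxFeasible k (f i)
          ≤⟨ success ⟩
        𝔼 (run 𝒜 (labelled (f i) Ss)) (f i)
          ≈⟨ ∑-cong (subsets n) (λ S → *-congʳ (run-cong 𝒜 (labelled-cong Ss
               (λ S ¬e → reflexive (≡.cong fromℕ (hard≡envelope (parts i) S ¬e))) unexposed) S)) ⟩
        𝔼 (blind Ss) (f i)
          ≈⟨ trans (+-congʳ (zeroʳ (α * K))) (+-identityˡ _) ⟨
        α * K * fromℕ 0 + 𝔼 (blind Ss) (f i) ∎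

      -- `success-gain` is averaged over the samples and summed over the groups. Exchanging the two
      -- sums collects all groups at one fixed sample, where `blind-gain` applies.
      gain-bound : ∀ {δ} → (∀ i → 1# - δ ≤ Pr D (success? i)) →
        fromℕ r * (α * K * (1# - δ)) ≤
        fromℕ r * (α * K) * ∑ (vectors (subsets n) m) (λ Ss → Π Ss * exposure Ss) + U
      gain-bound {δ} succeeds = begin
        fromℕ r * (α * K * (1# - δ))
          ≈⟨ *-congʳ (reflexive (≡.cong fromℕ (length-tabulate {n = r} (λ i → i)))) ⟨
        fromℕ (length (allFin r)) * (α * K * (1# - δ))
          ≈⟨ ∑-const (allFin r) _ ⟨
        ∑ (allFin r) (λ i → α * K * (1# - δ))
          ≤⟨ ∑-mono (allFin r) each ⟩
        ∑ (allFin r) (λ i → ∑ samples (λ Ss → Π Ss * (α * K * exposure Ss + 𝔼 (blind Ss) (f i))))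
          ≈⟨ ∑-swap (allFin r) samples _ ⟩
        ∑ samples (λ Ss → ∑ (allFin r) (λ i → Π Ss * (α * K * exposure Ss + 𝔼 (blind Ss) (f i))))
          ≤⟨ ∑-mono samples (λ Ss → begin
               ∑ (allFin r) (λ i → Π Ss * (α * K * exposure Ss + 𝔼 (blind Ss) (f i)))
                 ≈⟨ ∑-*ˡ (allFin r) (Π Ss) _ ⟩
               Π Ss * ∑ (allFin r) (λ i → α * K * exposure Ss + 𝔼 (blind Ss) (f i))
                 ≈⟨ *-congˡ (trans (∑-+ (allFin r) _ _) (+-congʳ (trans (∑-const (allFin r) _)
                      (*-congʳ (reflexive (≡.cong fromℕ (length-tabulate {n = r} (λ i → i)))))))) ⟩
               Π Ss * (fromℕ r * (α * K * exposure Ss) + ∑ (allFin r) (λ i → 𝔼 (blind Ss) (f i)))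
                 ≤⟨ *-monoʳ-≤ (Π≥0 Ss) (+-monoʳ-≤ _ (blind-gain Ss)) ⟩
               Π Ss * (fromℕ r * (α * K * exposure Ss) + U)
                 ≈⟨ solve 5 (λ p r a e u → p :* (r :* (a :* e) :+ u) := r :* a :* (p :* e) :+ p :* u) refl
                      (Π Ss) (fromℕ r) (α * K) (exposure Ss) U ⟩
               fromℕ r * (α * K) * (Π Ss * exposure Ss) + Π Ss * U ∎) ⟩
        ∑ samples (λ Ss → fromℕ r * (α * K) * (Π Ss * exposure Ss) + Π Ss * U)
          ≈⟨ trans (∑-+ samples _ _) (+-cong (∑-*ˡ samples (fromℕ r * (α * K)) _)
               (trans (∑-*ʳ samples U Π) (trans (*-congʳ (Π-total m)) (*-identityˡ U)))) ⟩
        fromℕ r * (α * K) * ∑ samples (λ Ss → Π Ss * exposure Ss) + U ∎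
        where
        samples = vectors (subsets n) m
        each : ∀ i → α * K * (1# - δ) ≤ ∑ samples (λ Ss → Π Ss * (α * K * exposure Ss + 𝔼 (blind Ss) (f i)))
        each i = begin
          α * K * (1# - δ)
            ≤⟨ *-monoʳ-≤ 0≤αK (succeeds i) ⟩
          α * K * Pr D (success? i)
            ≈⟨ *-congˡ (∑-filter (success? i) samples Π) ⟩
          α * K * ∑ samples (λ Ss → fromℕ (indicator (success? i Ss)) * Π Ss)
            ≈⟨ ∑-*ˡ samples (α * K) _ ⟨
          ∑ samples (λ Ss → α * K * (fromℕ (indicator (success? i Ss)) * Π Ss))
            ≤⟨ ∑-mono samples (λ Ss → begin
                 α * K * (fromℕ (indicator (success? i Ss)) * Π Ss)
                   ≈⟨ solve 3 (λ a s p → a :* (s :* p) := p :* (a :* s)) refl (α * K) _ (Π Ss) ⟩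
                 Π Ss * (α * K * fromℕ (indicator (success? i Ss)))
                   ≤⟨ *-monoʳ-≤ (Π≥0 Ss) (success-gain i Ss) ⟩
                 Π Ss * (α * K * exposure Ss + 𝔼 (blind Ss) (f i)) ∎) ⟩
          ∑ samples (λ Ss → Π Ss * (α * K * exposure Ss + 𝔼 (blind Ss) (f i))) ∎

  -- With R the left side, `gain-bound` times 2N reads 2R ≤ 2N p R + 2N U, because 1 - δ ≥ 1/N. The
  -- exposure probability p is at most 1/(2N), so one R cancels.
  optimizer-bound : ∀ {n r k b θ t m N α δ} {D : Distribution n} .{{_ : NonZero b}} → 2 ℕ.* θ ℕ.≤ b →
    HiddenPartitions n r k b → 0# ≤ α → 1# ≤ fromℕ N * (1# - δ) → 2 ℕ.* N ℕ.* m ℕ.≤ 2 ℕ.^ t →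
    OptimizableFromSamples NonnegativeMonotoneSubmodular α D k m δ →
    fromℕ r * (α * fromℕ (k ℕ.* θ)) ≤
      fromℕ (2 ℕ.* N) * fromℕ (θ ℕ.* k ℕ.+ r ℕ.* (k ℕ.* k ℕ.+ θ ℕ.* t))
  optimizer-bound {n} {r} {k} {b} {θ} {t} {m} {N} {α} {δ} {D} 2θ≤b hidden 0≤α 1≤N[1-δ] 2Nm≤2^t (𝒜 , succeeds)
    with T , T∈ , rare ← hidden-set-exists {θ = θ} {t} 2θ≤b hidden D = +-cancelʳ-≤ R (begin
      R + R
        ≈⟨ +-cong (*-identityʳ R) (*-identityʳ R) ⟨
      R * 1# + R * 1#
        ≤⟨ +-mono-≤ (*-monoʳ-≤ 0≤R 1≤N[1-δ]) (*-monoʳ-≤ 0≤R 1≤N[1-δ]) ⟩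
      R * (fromℕ N * (1# - δ)) + R * (fromℕ N * (1# - δ))
        ≈⟨ trans (solve 4 (λ r a n d → r :* a :* (n :* d) :+ r :* a :* (n :* d)
                                    := (n :+ n) :* (r :* (a :* d)))
             refl (fromℕ r) (α * fromℕ (k ℕ.* θ)) (fromℕ N) (1# - δ)) (*-congʳ (sym 2N≈)) ⟩
      2N * (fromℕ r * (α * fromℕ (k ℕ.* θ) * (1# - δ)))
        ≤⟨ *-monoʳ-≤ (0≤fromℕ (2 ℕ.* N))
             (gain-bound hidden T∈ D 𝒜 0≤α (λ i → succeeds (f hidden T∈ D 𝒜 i) (f∈𝓕 hidden T∈ D 𝒜 i))) ⟩
      2N * (R * p T + gain)
        ≈⟨ solve 4 (λ n r p u → n :* (r :* p :+ u) := r :* (n :* p) :+ n :* u) refl 2N R (p T) gain ⟩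
      R * (2N * p T) + 2N * gain
        ≤⟨ +-monoˡ-≤ _ (*-monoʳ-≤ 0≤R (2Np≤1 T rare)) ⟩
      R * 1# + 2N * gain
        ≈⟨ trans (+-congʳ (*-identityʳ R)) (+-comm R _) ⟩
      2N * gain + R ∎)
    where
    open Sampling (subsets n) (weight D) (nonnegative D) (total-weight D)
    R = fromℕ r * (α * fromℕ (k ℕ.* θ))
    2N = fromℕ (2 ℕ.* N)
    2ᵗ = fromℕ (2 ℕ.^ t)
    gain = fromℕ (θ ℕ.* k ℕ.+ r ℕ.* (k ℕ.* k ℕ.+ θ ℕ.* t))
    0≤R : 0# ≤ R
    0≤R = *-nonneg (0≤fromℕ r) (*-nonneg 0≤α (0≤fromℕ (k ℕ.* θ)))
    2N≈ : 2N ≈ fromℕ N + fromℕ N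
    2N≈ = trans (fromℕ-+ N (N ℕ.+ 0)) (+-congˡ (reflexive (≡.cong fromℕ (ℕ.+-identityʳ N))))
    p single : Subset n → Carrier
    p T = ∑ (vectors (subsets n) m) (λ Ss → Π Ss * fromℕ (indicator (any? (exposed? θ t T) Ss)))
    single T = ∑ (subsets n) (λ S → weight D S * fromℕ (indicator (exposed? θ t T S)))
    -- The union bound gives p ≤ m / 2^t, and 2 N m ≤ 2^t.
    2Np≤1 : ∀ T → 2ᵗ * single T ≤ 1# → 2N * p T ≤ 1#
    2Np≤1 T rare = *-cancelˡ-≤ (0<fromℕ (2 ℕ.^ t) {{ℕ.m^n≢0 2 t}}) (begin
      2ᵗ * (2N * p T)
        ≤⟨ *-monoʳ-≤ (0≤fromℕ (2 ℕ.^ t)) (*-monoʳ-≤ (0≤fromℕ (2 ℕ.* N)) (union-bound (exposed? θ t T) m)) ⟩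
      2ᵗ * (2N * (fromℕ m * single T))
        ≈⟨ trans (solve 4 (λ a b c d → a :* (b :* (c :* d)) := b :* c :* (a :* d)) refl
             2ᵗ 2N (fromℕ m) (single T))
             (*-congʳ (sym (fromℕ-* (2 ℕ.* N) m))) ⟩
      fromℕ (2 ℕ.* N ℕ.* m) * (2ᵗ * single T)
        ≤⟨ *-monoʳ-≤ (0≤fromℕ (2 ℕ.* N ℕ.* m)) rare ⟩
      fromℕ (2 ℕ.* N ℕ.* m) * 1#
        ≤⟨ *-monoˡ-≤ 0≤1 (fromℕ-mono-≤ 2Nm≤2^t) ⟩
      2ᵗ * 1# ∎)

-- Choice of the parameters and the final contradiction.

open import Data.Empty using (⊥)
import Data.Nat.Properties as ℕ
import Relation.Binary.PropositionalEquality.Core as ≡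

theorem6 : (𝓡 : CompleteOrderedField) →
    let open CompleteOrderedField 𝓡
        open Optimization 𝓡
    in
    (ε : Carrier) → 0# < ε →
    ∃ λ (k : ℕ → ℕ) →
    (m : ℕ → ℕ) → PolynomiallyBounded m →
    (δ : Carrier) → 0# ≤ δ → δ < 1# →
    ∃ λ (n₀ : ℕ) →
    (n : ℕ) .{{_ : NonZero n}} → n₀ ℕ.≤ n →
    (D : Distribution n) →
    ¬ OptimizableFromSamples NonnegativeMonotoneSubmodular
        (n ^ʳ (- (fromℕ 4 ⁻¹) + ε)) D (k n) (m n) δ
theorem6 𝓡 ε 0<ε with e′ , 1≤e′ε ← FieldProperties.archimedean-inverse 𝓡 0<ε =
  (λ n → q n ℕ.^ e) , λ m (c , p , m≤) δ _ δ<1 →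
  let N , 1≤N[1-δ] = archimedean-inverse (0<y-x δ<1)
      Q , Q-large  = exponential-beats-power (4 ℕ.* N ℕ.* c) (ℕ.suc d ℕ.* p)
      -- The summands serve in turn: `Q` for 2^q to exceed 2N times the number of samples, `2 ℕ.^ d`
      -- for n ≤ q^(d+1), 2 for 2θ ≤ qθ = x², and 6N + 1 for the last comparison.
      Q′           = Q ℕ.+ (2 ℕ.^ d ℕ.+ (2 ℕ.+ ℕ.suc (6 ℕ.* N)))
  in
  Q′ ℕ.^ d , λ n Q′^d≤n D optimizable → contradiction m c p m≤ N 1≤N[1-δ] n D optimizable Q-large
    (root-large d Q′ Q′^d≤n)
  where
  open CompleteOrderedField 𝓡
  open FieldProperties 𝓡
  open Indistinguishability 𝓡
  open Optimization 𝓡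

  -- The shift by 4 makes e - 1 = e′ + 3 and e - 3 = e′ + 1, the exponents in `θ` and `y`, natural
  -- numbers; 1 ≤ eε persists since e ≥ e′.
  e = 4 ℕ.+ e′
  d = 4 ℕ.* e

  q : ℕ → ℕ
  q n = proj₁ (root d n)

  -- `optimizer-bound` is applied with r = k = x, b = x² and t = q. The inequality 1 ≤ αy then
  -- eliminates `α`, and what remains is a false inequality between natural numbers.
  contradiction : ∀ m c p → (∀ n → m n ℕ.≤ c ℕ.* n ℕ.^ p ℕ.+ c) → ∀ N {δ} → 1# ≤ fromℕ N * (1# - δ) →
    ∀ n .{{_ : NonZero n}} (D : Distribution n) →
    OptimizableFromSamples NonnegativeMonotoneSubmodular
      (n ^ʳ (- (fromℕ 4 ⁻¹) + ε)) D (q n ℕ.^ e) (m n) δ →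
    ∀ {Q} → (∀ q → Q ℕ.≤ q → 4 ℕ.* N ℕ.* c ℕ.* q ℕ.^ (ℕ.suc d ℕ.* p) ℕ.≤ 2 ℕ.^ q) →
    Q ℕ.+ (2 ℕ.^ d ℕ.+ (2 ℕ.+ ℕ.suc (6 ℕ.* N))) ℕ.≤ q n → ⊥
  contradiction m c p m≤ N 1≤N[1-δ] n D optimizable {Q} Q-large Q′≤q =
    parameters-incompatible {N} e′ q₀ 6N<q (fromℕ-cancel-≤ (begin
      fromℕ (x ℕ.* (x ℕ.* θ))           ≈⟨ fromℕ-* x (x ℕ.* θ) ⟩
      fromℕ x * opt                       ≈⟨ *-identityʳ _ ⟨
      fromℕ x * opt * 1#                  ≤⟨ *-monoʳ-≤ (*-nonneg (0≤fromℕ x) (0≤fromℕ (x ℕ.* θ))) 1≤αy ⟩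
      fromℕ x * opt * (α * fromℕ y)
        ≈⟨ solve 4 (λ r k a y → r :* k :* (a :* y) := r :* (a :* k) :* y) refl (fromℕ x) opt α (fromℕ y) ⟩
      fromℕ x * (α * opt) * fromℕ y
        ≤⟨ *-monoˡ-≤ (0≤fromℕ y) (optimizer-bound {θ = θ} {q₀} {N = N} {D = D} 2θ≤b
             (hiddenPartitions x x (x ℕ.* x) x⁴≤n) 0≤α 1≤N[1-δ] 2Nm≤2^q optimizable) ⟩
      fromℕ (2 ℕ.* N) * fromℕ gain * fromℕ y
        ≈⟨ trans (*-congʳ (sym (fromℕ-* (2 ℕ.* N) gain))) (sym (fromℕ-* (2 ℕ.* N ℕ.* gain) y)) ⟩
      fromℕ (2 ℕ.* N ℕ.* gain ℕ.* y)       ∎))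
    where
    open Solver using (solve; _:=_; _:*_)
    q₀ = q n
    x = q₀ ℕ.^ e
    -- This is x²/q written without division.
    θ = x ℕ.* q₀ ℕ.^ (3 ℕ.+ e′)
    y = q₀ ℕ.^ ℕ.suc e′
    gain = θ ℕ.* x ℕ.+ x ℕ.* (x ℕ.* x ℕ.+ θ ℕ.* q₀)
    α = n ^ʳ (- (fromℕ 4 ⁻¹) + ε)
    opt = fromℕ (x ℕ.* θ)

    2^d≤q : 2 ℕ.^ d ℕ.≤ q₀
    2^d≤q = ℕ.≤-trans (ℕ.m≤m+n _ _) (ℕ.m+n≤o⇒n≤o Q Q′≤q)
    2+6N<q : 2 ℕ.+ ℕ.suc (6 ℕ.* N) ℕ.≤ q₀
    2+6N<q = ℕ.m+n≤o⇒n≤o (2 ℕ.^ d) (ℕ.m+n≤o⇒n≤o Q Q′≤q)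
    6N<q : 6 ℕ.* N ℕ.< q₀
    6N<q = ℕ.m+n≤o⇒n≤o 2 2+6N<q
    2≤q : 2 ℕ.≤ q₀
    2≤q = ℕ.m+n≤o⇒m≤o 2 2+6N<q
    instance
      q≢0 : NonZero q₀
      q≢0 = ℕ.>-nonZero (ℕ.≤-trans (ℕ.s≤s ℕ.z≤n) 2≤q)
      x≢0 : NonZero x
      x≢0 = ℕ.m^n≢0 q₀ e
      b≢0 : NonZero (x ℕ.* x)
      b≢0 = ℕ.m*n≢0 x x
      y≢0 : NonZero y
      y≢0 = ℕ.m^n≢0 q₀ (ℕ.suc e′)

    n≤ : n ℕ.≤ q₀ ℕ.^ ℕ.suc d
    n≤ = ℕ.≤-trans (ℕ.<⇒≤ (proj₂ (proj₂ (root d n)))) (suc^≤^suc q₀ d 2^d≤q)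

    x⁴≤n : x ℕ.* (x ℕ.* (x ℕ.* x)) ℕ.≤ n
    x⁴≤n = ℕ.≤-trans (ℕ.≤-reflexive (N.begin-equality
      x ℕ.* (x ℕ.* (x ℕ.* x))              N.≡⟨ ≡.cong (λ z → x ℕ.* (x ℕ.* (x ℕ.* z))) (ℕ.*-identityʳ x) ⟨
      x ℕ.^ 4                              N.≡⟨ ℕ.^-*-assoc q₀ e 4 ⟩
      q₀ ℕ.^ (e ℕ.* 4)                     N.≡⟨ ≡.cong (q₀ ℕ.^_) (ℕ.*-comm e 4) ⟩
      q₀ ℕ.^ d                             N.∎)) (proj₁ (proj₂ (root d n)))
      where
      module N = ℕ.≤-Reasoning

    2θ≤b : 2 ℕ.* θ ℕ.≤ x ℕ.* x
    2θ≤b = ℕ.≤-trans (ℕ.*-monoˡ-≤ θ 2≤q) (ℕ.≤-reflexive (≡.trans (≡.sym (ℕ.*-assoc q₀ x _))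
      (≡.trans (≡.cong (ℕ._* q₀ ℕ.^ (3 ℕ.+ e′)) (ℕ.*-comm q₀ x)) (ℕ.*-assoc x q₀ _))))

    2Nm≤2^q : 2 ℕ.* N ℕ.* m n ℕ.≤ 2 ℕ.^ q₀
    2Nm≤2^q = ℕ.≤-trans
      (bounded-after-scaling c p (ℕ.suc d) N q₀
        (ℕ.≤-trans (m≤ n) (ℕ.+-monoˡ-≤ c (ℕ.*-monoʳ-≤ c (ℕ.^-monoˡ-≤ p n≤)))) (ℕ.≤-trans (ℕ.s≤s ℕ.z≤n) 2≤q))
      (Q-large q₀ (ℕ.m+n≤o⇒m≤o Q Q′≤q))

    1≤αy : 1# ≤ α * fromℕ y
    1≤αy = power-lower-bound e′ q₀ n (≤-trans 1≤e′ε (*-monoˡ-≤ (proj₁ 0<ε) (fromℕ-mono-≤ (ℕ.m≤n+m e′ 4)))) n≤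

    0≤α : 0# ≤ α
    0≤α = *-cancelˡ-≤ (0<fromℕ y) (begin
      fromℕ y * 0#   ≈⟨ zeroʳ (fromℕ y) ⟩
      0#             ≤⟨ 0≤1 ⟩
      1#             ≤⟨ 1≤αy ⟩
      α * fromℕ y    ≈⟨ *-comm α (fromℕ y) ⟩
      fromℕ y * α    ∎)
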